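{- The decision problem Strong Geodetic Recognition (given a graph $G=(V,E)$ of diameter $D$ and a vertex set $S\subseteq V(G)$ with $|S|=k$, decide whether $S$ is a strong geodetic set of $G$) is fixed-parameter tractable with respect to the parameters $D$ and $k$ in conjunction.
   Context: All graphs are finite, simple, undirected and connected. The diameter of $G$ is the greatest distance between two of its vertices. A shortest path assignment $I(S)$ of a vertex set $S\subseteq V(G)$ consists of exactly one chosen shortest path of $G$ between $u$ and $v$ for each unordered pair of distinct vertices $u,v\in S$. The set $S$ is a strong geodetic set of $G$ if there is a shortest path assignment $I(S)$ such that every vertex of $V(G)\setminus S$ lies on some path of $I(S)$ (for $|S|\ge 2$ this is the same as $\bigcup_{P\in I(S)}V(P)=V(G)$). A problem is fixed-parameter tractable with respect to $D$ and $k$ in conjunction if it can be solved by an algorithm running in time $\mathcal{O}(f(D,k)\cdot n^{c})$, where $n$ is the size of the input instance, $c$ is a positive constant and $f$ is a computable function. -}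

module Defs where

open import Data.Bool using (Bool; true; false; T)
open import Data.Fin using (Fin; zero; suc) renaming (_<_ to _<ᶠ_)
open import Data.Fin.Subset using (Subset; _∈_; _∉_; ∣_∣)
open import Data.List using (List; []; _∷_; foldr; tabulate)
import Data.List.Membership.Propositional as List
open import Data.List.Relation.Unary.Unique.Propositional using (Unique)
open import Data.Nat using (ℕ; zero; suc; _+_; _*_; _^_; _≤_; _<_)
open import Data.Product using (Σ-syntax; ∃-syntax; _×_)
open import Data.Vec using (Vec; lookup; _[_]≔_; replicate; toList)
  renaming (_∷_ to _∷ᵛ_; map to mapᵛ)
open import Relation.Binary.PropositionalEquality using (_≡_; _≢_)
open import Relation.Nullary.Reflects using (Reflects)

-- Graphs

record Graph : Set where
  field
    order      : ℕ
    adj        : Fin order → Fin order → Bool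
    adj-sym    : ∀ u v → adj u v ≡ adj v u
    adj-irrefl : ∀ v → adj v v ≡ false

  Vertex : Set
  Vertex = Fin order

  data Walk : Vertex → Vertex → Set where
    stop : ∀ v → Walk v v
    step : ∀ u {v w} → T (adj u v) → Walk v w → Walk u w

  walkVertices : ∀ {u v} → Walk u v → List Vertex
  walkVertices (stop v)     = v ∷ []
  walkVertices (step u _ w) = u ∷ walkVertices w

  walkLength : ∀ {u v} → Walk u v → ℕ
  walkLength (stop _)     = 0
  walkLength (step _ _ w) = suc (walkLength w)

  record Path (u v : Vertex) : Set where
    field
      walk   : Walk u v
      simple : Unique (walkVertices walk)

    vertices : List Vertex
    vertices = walkVertices walk

    length : ℕ
    length = walkLength walk

  IsShortest : ∀ {u v} → Path u v → Set
  IsShortest {u} {v} P = ∀ (Q : Path u v) → Path.length P ≤ Path.length Q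

  record ShortestPath (u v : Vertex) : Set where
    field
      path     : Path u v
      shortest : IsShortest path

    open Path path public

  Connected : Set
  Connected = ∀ u v → Path u v

  IsDistance : Vertex → Vertex → ℕ → Set
  IsDistance u v d = Σ[ P ∈ ShortestPath u v ] ShortestPath.length P ≡ d

  -- The graph with no vertices has no diameter.
  IsDiameter : ℕ → Set
  IsDiameter D = (∃[ u ] ∃[ v ] IsDistance u v D)
               × (∀ u v d → IsDistance u v d → d ≤ D)

  -- An unordered pair of distinct vertices is represented by its increasing
  -- listing u < v.  Membership and order proofs are unique, so exactly one
  -- path is chosen for each pair.
  ShortestPathAssignment : Subset order → Set
  ShortestPathAssignment S =
    ∀ u v → u ∈ S → v ∈ S → u <ᶠ v → ShortestPath u v

  IsStrongGeodetic : Subset order → Set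
  IsStrongGeodetic S =
    Σ[ I ∈ ShortestPathAssignment S ]
      (∀ x → x ∉ S →
        ∃[ u ] ∃[ v ] Σ[ u∈S ∈ u ∈ S ] Σ[ v∈S ∈ v ∈ S ] Σ[ u<v ∈ u <ᶠ v ]
          x List.∈ ShortestPath.vertices (I u v u∈S v∈S u<v))

-- The model of computation is the WHILE language of N. D. Jones
-- ("Computability and Complexity from a Programming Perspective"): imperative
-- programs over binary trees, where every elementary operation has unit cost.
-- It is Turing complete, and since trees can be shared in memory its running
-- times are polynomially related to those of Turing machines.

data Tree : Set where
  nil : Tree
  _∙_ : Tree → Tree → Tree

infixr 5 _∙_

size : Tree → ℕ
size nil     = 1
size (s ∙ t) = suc (size s + size t)

head tail : Tree → Tree
head nil     = nil
head (s ∙ _) = s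
tail nil     = nil
tail (_ ∙ t) = t

data Expr (m : ℕ) : Set where
  var   : Fin m → Expr m
  nil   : Expr m
  cons  : Expr m → Expr m → Expr m
  hd tl : Expr m → Expr m

infix  6 _≔_
infixr 5 _⨾_

data Command (m : ℕ) : Set where
  _≔_      : Fin m → Expr m → Command m
  _⨾_      : Command m → Command m → Command m
  while_⟨_⟩ : Expr m → Command m → Command m

Store : ℕ → Set
Store m = Vec Tree m

eval : ∀ {m} → Expr m → Store m → Tree
eval (var x)    σ = lookup σ x
eval nil        σ = nil
eval (cons e f) σ = eval e σ ∙ eval f σ
eval (hd e)     σ = head (eval e σ)
eval (tl e)     σ = tail (eval e σ)

exprTime : ∀ {m} → Expr m → ℕ
exprTime (var _)    = 1
exprTime nil        = 1
exprTime (cons e f) = suc (exprTime e + exprTime f)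
exprTime (hd e)     = suc (exprTime e)
exprTime (tl e)     = suc (exprTime e)

-- ⟨ C , σ ⟩⇓ σ′ [ t ]: started in store σ, the command C halts in store σ′
-- after t units of time.  A loop runs as long as its guard is not nil.
data ⟨_,_⟩⇓_[_] {m : ℕ} : Command m → Store m → Store m → ℕ → Set where
  assign : ∀ {x e σ} →
           ⟨ x ≔ e , σ ⟩⇓ (σ [ x ]≔ eval e σ) [ suc (exprTime e) ]
  seq    : ∀ {C C′ σ σ′ σ″ t t′} →
           ⟨ C , σ ⟩⇓ σ′ [ t ] → ⟨ C′ , σ′ ⟩⇓ σ″ [ t′ ] →
           ⟨ C ⨾ C′ , σ ⟩⇓ σ″ [ t + t′ ]
  done   : ∀ {e C σ} → eval e σ ≡ nil →
           ⟨ while e ⟨ C ⟩ , σ ⟩⇓ σ [ suc (exprTime e) ]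
  loop   : ∀ {e C σ σ′ σ″ t t′} → eval e σ ≢ nil →
           ⟨ C , σ ⟩⇓ σ′ [ t ] → ⟨ while e ⟨ C ⟩ , σ′ ⟩⇓ σ″ [ t′ ] →
           ⟨ while e ⟨ C ⟩ , σ ⟩⇓ σ″ [ suc (exprTime e) + t + t′ ]

record Program : Set where
  field
    extraVars : ℕ
    body      : Command (suc extraVars)

-- Variable 0 holds the input at the start and the output at the end; all
-- other variables are initially nil.
record Runs (p : Program) (input output : Tree) (time : ℕ) : Set where
  open Program p
  field
    final   : Store (suc extraVars)
    halts   : ⟨ body , input ∷ᵛ replicate extraVars nil ⟩⇓ final [ time ]
    outputs : lookup final zero ≡ output

encodeBool : Bool → Tree
encodeBool false = nil
encodeBool true  = nil ∙ nil

encodeℕ : ℕ → Tree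
encodeℕ zero    = nil
encodeℕ (suc n) = nil ∙ encodeℕ n

encodeList : List Tree → Tree
encodeList = foldr _∙_ nil

Computable₂ : (ℕ → ℕ → ℕ) → Set
Computable₂ f = ∃[ p ] (∀ a b → ∃[ t ]
  Runs p (encodeℕ a ∙ encodeℕ b) (encodeℕ (f a b)) t)

-- Decision problems with two parameters

record ParameterizedProblem : Set₁ where
  field
    Instance  : Set
    encode    : Instance → Tree
    Yes       : Instance → Set
    param₁    : Instance → ℕ
    param₂    : Instance → ℕ

-- Solvable in time O(f(param₁, param₂) · nᶜ), where n is the size of the
-- encoded instance and K is the constant hidden in the O.
FixedParameterTractable : ParameterizedProblem → Set
FixedParameterTractable problem =
  ∃[ p ] ∃[ f ] ∃[ c ] ∃[ K ]
    Computable₂ f × 0 < c ×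
    (∀ (i : Instance) → ∃[ answer ] ∃[ t ]
      Runs p (encode i) (encodeBool answer) t ×
      Reflects (Yes i) answer ×
      t ≤ K * (f (param₁ i) (param₂ i) * size (encode i) ^ c))
  where open ParameterizedProblem problem

record RecognitionInstance : Set where
  field
    graph       : Graph
  open Graph graph
  field
    connected   : Connected
    D           : ℕ
    hasDiameter : IsDiameter D
    S           : Subset order

-- The input consists of the adjacency matrix, row by row, and the
-- characteristic vector of S; the diameter is not given to the algorithm.
encodeInstance : RecognitionInstance → Tree
encodeInstance i =
  encodeList (tabulate λ u → encodeList (tabulate λ v → encodeBool (adj u v)))
  ∙ encodeList (toList (mapᵛ encodeBool S))
  where
  open RecognitionInstance i
  open Graph graph

StrongGeodeticRecognition : ParameterizedProblem
StrongGeodeticRecognition = record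
  { Instance = RecognitionInstance
  ; encode   = encodeInstance
  ; Yes      = λ i → let open RecognitionInstance i in
                     Graph.IsStrongGeodetic graph S
  ; param₁   = RecognitionInstance.D
  ; param₂   = λ i → ∣ RecognitionInstance.S i ∣
  }

{-# OPTIONS --safe #-}
module Submission where

-- A state is a list of vertex pairs ("segments"), initially the pairs u < v
-- of S.  The vertices x outside S are treated one after another: x is put on
-- some segment (a , b) with d a x + d x b ≤ d a b, which is then replaced by
-- (a , x) and (x , b).  A system of geodesics for the segments of a state
-- that passes through x can be cut at x, and conversely geodesics from a to x
-- and from x to b can be joined, so S is strong geodetic iff some sequence of
-- choices treats all x.
--
-- Splitting never increases the sum of d a b over the segments, which is at
-- most k² D at the start, while every segment has positive length.  Hence a
-- state has at most k² D segments, and since each step adds one, no state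
-- survives k² D + 1 steps.  With B = k² D + 1 the list of all states reached
-- thus never has more than B ^ B elements, although the program knows
-- neither D nor k.
--
-- The program is written in a small first-order functional language with list
-- recursion.  A compiled term runs in time O(N ^ c), where N bounds the
-- lengths of all lists that are traversed and c is the nesting depth of the
-- recursions.

open import Data.Bool using (Bool; true; false; if_then_else_; T)
import Data.Bool as Bool
open import Data.Empty using (⊥)
open import Data.Fin using (Fin; zero; suc; toℕ)
open import Data.Fin.Properties using (toℕ<n; toℕ-injective; injective⇒≤)
open import Data.Fin.Subset using (Subset; ∣_∣) renaming (_∈_ to _∈ₛ_; _∉_ to _∉ₛ_)
open import Data.List
  using (List; []; _∷_; _++_; _ʳ++_; foldr; length; map; reverse; replicate; tabulate; allFin;
         filter; cartesianProduct)
import Data.List as List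
open import Data.List.Membership.Propositional using (_∈_; _∉_)
open import Data.List.Membership.Propositional.Properties
open import Data.List.Membership.Propositional.Properties.WithK using (unique⇒irrelevant)
open import Data.List.Properties
  using (length-reverse; reverse-involutive; map-tabulate; tabulate-cong; length-replicate;
         length-tabulate; length-++; length-map; foldr-cong; ++-identityʳ; filter-++; length-filter)
open import Data.List.Relation.Unary.All using (All; []; _∷_)
import Data.List.Relation.Unary.All as All
open import Data.List.Relation.Unary.All.Properties using (¬Any⇒All¬)
open import Data.List.Relation.Unary.AllPairs using ([]; _∷_)
open import Data.List.Relation.Unary.Any using (here; there)
open import Data.List.Relation.Unary.Any.Properties using (¬Any[])
open import Data.List.Relation.Unary.Unique.Propositional using (Unique)
open import Data.List.Relation.Unary.Unique.Propositional.Properties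
  using (allFin⁺; filter⁺; cartesianProduct⁺)
open import Data.Nat
  using (ℕ; zero; suc; pred; _+_; _*_; _^_; _∸_; _⊔_; _≤_; _<_; z≤n; s≤s; s≤s⁻¹)
open import Data.Nat.Properties
open import Data.Nat.Tactic.RingSolver using (solve-∀)
open import Data.Product using (_×_; _,_; proj₁; proj₂; Σ-syntax; ∃-syntax)
open import Data.Sum using (_⊎_; inj₁; inj₂; map₁; map₂; [_,_]′)
open import Data.Unit using (⊤; tt)
open import Data.Vec using ([]; _∷_; lookup; toList)
import Data.Vec as Vec
open import Data.Vec.Properties using ([]=⇒lookup; lookup⇒[]=)
open import Data.Vec.Properties.WithK using ([]=-irrelevant)
open import Function using (_∘_; id)
open import Relation.Binary.PropositionalEquality
  using (_≡_; _≢_; refl; sym; trans; cong; cong₂; subst; subst₂; module ≡-Reasoning)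
open import Relation.Nullary using (¬_; contradiction)
open import Relation.Nullary.Reflects using (Reflects; ofʸ; ofⁿ)

open import Defs

-- Machine code with certified running times

-- The constants belong to a time bound coeff * N ^ degree, where N bounds the
-- lengths of all lists that are traversed.
record Code : Set where
  constructor code
  field
    command : Command 1
    coeff   : ℕ
    degree  : ℕ

open Code

X : Expr 1
X = var zero

set : Expr 1 → Code
set e = code (zero ≔ e) (suc (exprTime e)) 0

infixr 5 _⨟_

_⨟_ : Code → Code → Code
c ⨟ c′ = code (command c ⨾ command c′) (coeff c + coeff c′) (degree c ⊔ degree c′)

-- At most `N` rounds raise the degree by one. One copy of `g` pays for the last test of the guard,
-- the other for the test in each round.
repeat : Expr 1 → Code → Code
repeat e c = code while e ⟨ command c ⟩ (g + (g + coeff c)) (suc (degree c))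
  where
  g : ℕ
  g = suc (exprTime e)

-- The constants belong to the code and not to the run, so one polynomial bounds all its runs; what
-- a particular run demands of `N` is collected in `Cond`.
record Exec (c : Code) (s s′ : Tree) (Cond : ℕ → Set) : Set where
  constructor exec
  field
    {time} : ℕ
    run    : ⟨ command c , s ∷ [] ⟩⇓ s′ ∷ [] [ time ]
    bound  : ∀ {N} → 1 ≤ N → Cond N → time ≤ coeff c * N ^ degree c

open Exec

Free : ℕ → Set
Free _ = ⊤

exec-set : ∀ e s → Exec (set e) s (eval e (s ∷ [])) Free
exec-set e s = exec assign λ _ _ → ≤-reflexive (sym (*-identityʳ _))

exec-cond : ∀ {c s s′} {P Q : ℕ → Set} → (∀ {N} → 1 ≤ N → Q N → P N) →
            Exec c s s′ P → Exec c s s′ Q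
exec-cond Q⇒P E = exec (run E) λ 1≤N q → bound E 1≤N (Q⇒P 1≤N q)

^-mono-exponent : ∀ {N} a {d e} → 1 ≤ N → d ≤ e → a * N ^ d ≤ a * N ^ e
^-mono-exponent {suc N} a _ d≤e = *-monoʳ-≤ a (^-monoʳ-≤ (suc N) d≤e)

const≤ : ∀ {N} → 1 ≤ N → ∀ d a → a ≤ a * N ^ d
const≤ 1≤N d a = ≤-trans (≤-reflexive (sym (*-identityʳ a)))
                         (^-mono-exponent a {0} {d} 1≤N z≤n)

exec-skip : ∀ {e c s} → eval e (s ∷ []) ≡ nil → Exec (repeat e c) s s Free
exec-skip {e} {c} stops = exec (done stops) λ 1≤N _ →
  ≤-trans (m≤m+n g (g + coeff c)) (const≤ 1≤N (suc (degree c)) (g + (g + coeff c)))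
  where
  g : ℕ
  g = suc (exprTime e)

exec-once : ∀ {e c s s′ P} → eval e (s ∷ []) ≢ nil → Exec c s s′ P →
            eval e (s′ ∷ []) ≡ nil → Exec (repeat e c) s s′ P
exec-once {e} {c} {s} {s′} goes E stops =
  exec (loop goes (run E) (done stops)) λ {N} 1≤N p → begin
    g + time E + g
      ≡⟨ +-assoc g (time E) g ⟩
    g + (time E + g)
      ≡⟨ cong (g +_) (+-comm (time E) g) ⟩
    g + (g + time E)
      ≤⟨ +-mono-≤ (const≤ 1≤N d g) (+-mono-≤ (const≤ 1≤N d g)
           (≤-trans (bound E 1≤N p) (^-mono-exponent (coeff c) 1≤N (n≤1+n (degree c))))) ⟩
    g * N ^ d + (g * N ^ d + coeff c * N ^ d)
      ≡⟨ rearrange g (coeff c) (N ^ d) ⟩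
    (g + (g + coeff c)) * N ^ d
      ∎
  where
  open ≤-Reasoning
  g d : ℕ
  g = suc (exprTime e)
  d = suc (degree c)
  rearrange : ∀ g k M → g * M + (g * M + k * M) ≡ (g + (g + k)) * M
  rearrange = solve-∀

exec-seq : ∀ {c c′ s s′ s″} {P P′ : ℕ → Set} →
           Exec c s s′ P → Exec c′ s′ s″ P′ →
           Exec (c ⨟ c′) s s″ (λ N → P N × P′ N)
exec-seq {c} {c′} E E′ = exec (seq (run E) (run E′)) λ {N} 1≤N (p , p′) →
  ≤-trans
    (+-mono-≤
      (≤-trans (bound E 1≤N p)
        (^-mono-exponent (coeff c) 1≤N (m≤m⊔n (degree c) (degree c′))))
      (≤-trans (bound E′ 1≤N p′)
        (^-mono-exponent (coeff c′) 1≤N (m≤n⊔m (degree c) (degree c′)))))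
    (≤-reflexive (sym (*-distribʳ-+ _ (coeff c) (coeff c′))))

-- Each element is seen together with its tail because in a right fold the tail determines the
-- accumulator that the element meets.
Suffixes : {A : Set} → (A → List A → Set) → List A → Set
Suffixes P []       = ⊤
Suffixes P (x ∷ xs) = P x xs × Suffixes P xs

suffixes-map : ∀ {A : Set} {P Q : A → List A → Set} → (∀ {x xs} → P x xs → Q x xs) →
               ∀ xs → Suffixes P xs → Suffixes Q xs
suffixes-map f []       _        = tt
suffixes-map f (x ∷ xs) (p , ps) = f p , suffixes-map f xs ps

suffixes-universal : ∀ {A : Set} {P : A → List A → Set} → (∀ x xs → P x xs) →
                     ∀ xs → Suffixes P xs
suffixes-universal p []       = tt
suffixes-universal p (x ∷ xs) = p x xs , suffixes-universal p xs

suffixes-hereditary : ∀ {A : Set} {P : A → List A → Set} (Q : List A → Set) →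
  (∀ x xs → Q (x ∷ xs) → Q xs) → (∀ x xs → Q (x ∷ xs) → P x xs) → ∀ xs → Q xs → Suffixes P xs
suffixes-hereditary Q down f []       q = tt
suffixes-hereditary Q down f (x ∷ xs) q = f x xs q , suffixes-hereditary Q down f xs (down x xs q)

suffixes-ʳ++ : ∀ {A : Set} {P : A → List A → Set} ys {zs} →
               Suffixes P (ys ʳ++ zs) → Suffixes P zs
suffixes-ʳ++ []       p = p
suffixes-ʳ++ (y ∷ ys) p = proj₂ (suffixes-ʳ++ ys p)

-- The state of a loop over a list is given by the elements still to come and
-- the elements already treated, the latest one first.
module _ {A : Set} (stack : List A → List A → Tree) {e : Expr 1} {c : Code}
  {P : ℕ → A → List A → Set}
  (halt : ∀ zs → eval e (stack [] zs ∷ []) ≡ nil)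
  (go   : ∀ y ys zs → eval e (stack (y ∷ ys) zs ∷ []) ≢ nil)
  (body : ∀ y ys zs →
          Exec c (stack (y ∷ ys) zs) (stack ys (y ∷ zs)) (λ N → P N y zs))
  where

  private
    g : ℕ
    g = suc (exprTime e)

    record Loop (ys zs : List A) : Set where
      constructor loops
      field
        {steps} : ℕ
        runs    : ⟨ while e ⟨ command c ⟩ , stack ys zs ∷ [] ⟩⇓
                  stack [] (ys ʳ++ zs) ∷ [] [ steps ]
        bounded : ∀ {N} → 1 ≤ N → Suffixes (P N) (ys ʳ++ zs) →
                  steps ≤ g + length ys * (g + coeff c * N ^ degree c)

    iterate : ∀ ys zs → Loop ys zs
    iterate []       zs = loops (done (halt zs)) λ _ _ → m≤m+n g 0
    iterate (y ∷ ys) zs with iterate ys (y ∷ zs)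
    -- The elements treated before `y` form a suffix of the final pile, from which the condition on
    -- `y` is read off.
    ... | loops r b = loops (loop (go y ys zs) (run (body y ys zs)) r) λ 1≤N p →
      ≤-trans
        (+-mono-≤ (+-monoʳ-≤ g
          (bound (body y ys zs) 1≤N (proj₁ (suffixes-ʳ++ ys p)))) (b 1≤N p))
        (≤-reflexive (rearrange g _ (length ys * _)))
      where
      rearrange : ∀ x y z → x + y + (x + z) ≡ x + (x + y + z)
      rearrange = solve-∀

  exec-repeat : ∀ ys zs →
    Exec (repeat e c) (stack ys zs) (stack [] (ys ʳ++ zs))
         (λ N → length ys ≤ N × Suffixes (P N) (ys ʳ++ zs))
  exec-repeat ys zs with iterate ys zs
  ... | loops r b = exec r λ {N} 1≤N (ys≤N , p) → begin
    _
      ≤⟨ b 1≤N p ⟩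
    g + length ys * (g + coeff c * N ^ d)
      ≤⟨ +-monoʳ-≤ g (*-monoˡ-≤ _ ys≤N) ⟩
    g + N * (g + coeff c * N ^ d)
      ≤⟨ +-mono-≤ (const≤ 1≤N (suc d) g) (*-monoʳ-≤ N (+-monoˡ-≤ _ (const≤ 1≤N d g))) ⟩
    g * N ^ suc d + N * (g * N ^ d + coeff c * N ^ d)
      ≡⟨ rearrange g (coeff c) N (N ^ d) ⟩
    (g + (g + coeff c)) * N ^ suc d
      ∎
    where
    open ≤-Reasoning
    d = degree c
    rearrange : ∀ g k N M → g * (N * M) + N * (g * M + k * M) ≡ (g + (g + k)) * (N * M)
    rearrange = solve-∀

-- A first-order functional language

record Type : Set₁ where
  constructor type
  field
    Carrier : Set
    encode  : Carrier → Tree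

open Type

data Env : List Type → Set₁ where
  []  : Env []
  _∷_ : ∀ {τ Γ} → Carrier τ → Env Γ → Env (τ ∷ Γ)

infix 4 _∋_

data _∋_ : List Type → Type → Set₁ where
  here  : ∀ {τ Γ} → τ ∷ Γ ∋ τ
  there : ∀ {σ τ Γ} → Γ ∋ τ → σ ∷ Γ ∋ τ

fetch : ∀ {Γ τ} → Env Γ → Γ ∋ τ → Carrier τ
fetch (v ∷ ρ) here      = v
fetch (v ∷ ρ) (there x) = fetch ρ x

push : ∀ {Γ} → Env Γ → Tree → Tree
push []              s = s
push (_∷_ {τ} v ρ) s = encode τ v ∙ push ρ s

-- The store is used as a stack: a program replaces its arguments on top by the result and leaves
-- the rest `s` as it was.
record Fun (Δ : List Type) (τ : Type) : Set₁ where
  field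
    apply   : Env Δ → Carrier τ
    Cond    : ℕ → Env Δ → Set
    program : Code
    execute : ∀ ρ s →
      Exec program (push ρ s) (encode τ (apply ρ) ∙ s) (λ N → Cond N ρ)

open Fun

encodes : (τ : Type) → List (Carrier τ) → Tree
encodes τ xs = encodeList (map (encode τ) xs)

list : Type → Type
list τ = type (List (Carrier τ)) (encodes τ)

infix 4 _⊢_ _⊢*_

data _⊢_ (Γ : List Type) : Type → Set₁
data _⊢*_ (Γ : List Type) : List Type → Set₁
⟦_⟧  : ∀ {Γ τ} → Γ ⊢ τ → Env Γ → Carrier τ
⟦_⟧* : ∀ {Γ Δ} → Γ ⊢* Δ → Env Γ → Env Δ

data _⊢_ Γ where
  var    : ∀ {τ} → Γ ∋ τ → Γ ⊢ τ
  call   : ∀ {Δ τ} → Fun Δ τ → Γ ⊢* Δ → Γ ⊢ τ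
  fold   : ∀ {σ τ} → Γ ⊢ list σ → Γ ⊢ τ → σ ∷ τ ∷ Γ ⊢ τ → Γ ⊢ τ
  -- Reads the computed tree as the code of another value, possibly of another
  -- type.
  retype : ∀ {σ τ} (t : Γ ⊢ σ) (g : Env Γ → Carrier τ) →
           (∀ ρ → encode σ (⟦ t ⟧ ρ) ≡ encode τ (g ρ)) → Γ ⊢ τ

data _⊢*_ Γ where
  []  : Γ ⊢* []
  _∷_ : ∀ {τ Δ} → Γ ⊢ τ → Γ ⊢* Δ → Γ ⊢* τ ∷ Δ

⟦ var x ⟧ ρ        = fetch ρ x
⟦ call F as ⟧ ρ    = apply F (⟦ as ⟧* ρ)
⟦ fold l z b ⟧ ρ   = foldr (λ x acc → ⟦ b ⟧ (x ∷ acc ∷ ρ)) (⟦ z ⟧ ρ) (⟦ l ⟧ ρ)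
⟦ retype t g _ ⟧ ρ = g ρ
⟦ [] ⟧* ρ          = []
⟦ a ∷ as ⟧* ρ      = ⟦ a ⟧ ρ ∷ ⟦ as ⟧* ρ

-- The demands on `N` depend on the data, so they are collected along the values that actually
-- occur: under a fold, `b` is examined at each element with the accumulator computed from its tail.
Affordable  : ∀ {Γ τ} → ℕ → Γ ⊢ τ → Env Γ → Set
Affordable* : ∀ {Γ Δ} → ℕ → Γ ⊢* Δ → Env Γ → Set
Affordable N (var x) ρ        = ⊤
Affordable N (call F as) ρ    = Affordable* N as ρ × Cond F N (⟦ as ⟧* ρ)
Affordable N (fold l z b) ρ   =
  Affordable N l ρ × Affordable N z ρ × length (⟦ l ⟧ ρ) ≤ N ×
  Suffixes (λ x xs → Affordable N b
                       (x ∷ foldr (λ x acc → ⟦ b ⟧ (x ∷ acc ∷ ρ)) (⟦ z ⟧ ρ) xs ∷ ρ))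
           (⟦ l ⟧ ρ)
Affordable N (retype t _ _) ρ = Affordable N t ρ
Affordable* N [] ρ            = ⊤
Affordable* N (a ∷ as) ρ      = Affordable N a ρ × Affordable* N as ρ

-- Compilation of terms to stack code.

nth : ℕ → Tree → Tree
nth zero    s = head s
nth (suc p) s = nth p (tail s)

drop nthExpr : ℕ → Expr 1 → Expr 1
drop zero    e = e
drop (suc p) e = drop p (tl e)
nthExpr p e = hd (drop p e)

eval-nthExpr : ∀ p e s → eval (nthExpr p e) s ≡ nth p (eval e s)
eval-nthExpr zero    e s = refl
eval-nthExpr (suc p) e s = eval-nthExpr p (tl e) s

Layout : List Type → Set₁
Layout Γ = ∀ {τ} → Γ ∋ τ → ℕ

-- Slot 1 holds the rest of the list during a fold.
bind : ∀ {σ τ Γ} → Layout Γ → Layout (σ ∷ τ ∷ Γ)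
bind pos here              = 0
bind pos (there here)      = 2
bind pos (there (there x)) = 3 + pos x

Fits : ∀ {Γ} → Layout Γ → Env Γ → Tree → Set₁
Fits {Γ} pos ρ s = ∀ {τ} (x : Γ ∋ τ) → nth (pos x) s ≡ encode τ (fetch ρ x)

compile  : ∀ {Γ τ} → Layout Γ → Γ ⊢ τ → Code
compile* : ∀ {Γ Δ} → Layout Γ → Γ ⊢* Δ → Code
compile pos (var x)        = set (cons (nthExpr (pos x) X) X)
compile pos (call F as)    = compile* pos as ⨟ program F
compile pos (fold l z b) =
  compile pos z ⨟ compile (suc ∘ pos) l ⨟
  set (cons (hd X) (cons nil (tl X))) ⨟
  -- A right fold consumes its list from the end, so the list is first reversed into the slot below
  -- it.
  repeat (hd X) (set (cons (tl (hd X)) (cons (cons (hd (hd X)) (nthExpr 1 X)) (drop 2 X)))) ⨟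
  set (tl X) ⨟
  repeat (hd X)
    -- The current element is copied above the list and the accumulator, as `bind` expects.
    -- Afterwards the value of the body replaces the accumulator and the list loses its head.
    (set (cons (hd (hd X)) X) ⨟
     compile (bind pos) b ⨟
     set (cons (tl (nthExpr 2 X)) (cons (hd X) (drop 4 X)))) ⨟
  set (tl X)
compile pos (retype t _ _) = compile pos t
compile* pos []               = set X
-- Arguments are evaluated from the last to the first, so that the first one ends on top; the
-- variables then lie below `length Δ` values already pushed.
compile* pos (_∷_ {Δ = Δ} a as) = compile* pos as ⨟ compile ((length Δ +_) ∘ pos) a

nth-push : ∀ {Γ} (ρ : Env Γ) p s → nth (length Γ + p) (push ρ s) ≡ nth p s
nth-push []      p s = refl
nth-push (v ∷ ρ) p s = nth-push ρ p s

exec-to : ∀ {c s s′ s″ P} → s′ ≡ s″ → Exec c s s′ P → Exec c s s″ P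
exec-to refl E = E

exec-compile : ∀ {Γ τ} (pos : Layout Γ) (t : Γ ⊢ τ) ρ s → Fits pos ρ s →
  Exec (compile pos t) s (encode τ (⟦ t ⟧ ρ) ∙ s) (λ N → Affordable N t ρ)
exec-compile* : ∀ {Γ Δ} (pos : Layout Γ) (as : Γ ⊢* Δ) ρ s → Fits pos ρ s →
  Exec (compile* pos as) s (push (⟦ as ⟧* ρ) s) (λ N → Affordable* N as ρ)
exec-compile pos (var x) ρ s fits =
  exec-to (cong (_∙ s) (trans (eval-nthExpr (pos x) X _) (fits x))) (exec-set _ s)
exec-compile pos (call F as) ρ s fits =
  exec-seq (exec-compile* pos as ρ s fits) (execute F (⟦ as ⟧* ρ) s)
exec-compile {τ = τ} pos (fold {σ} l z b) ρ s fits =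
  exec-cond (λ { _ (okl , okz , short , okb) →
               okz , okl , tt , (short , suffixes-universal (λ _ _ → tt) (xs ʳ++ [])) , tt ,
               (≤-trans (≤-reflexive (length-reverse xs)) short ,
                -- The folding loop runs over `reverse xs` and piles up what it has treated, so the
                -- pile is `xs` again and the pairs of element and tail are those of the source
                -- fold.
                subst (Suffixes _) (sym (reverse-involutive xs))
                      (suffixes-map (λ ok → tt , ok , tt) xs okb)) , tt }) (
  exec-seq (exec-compile pos z ρ s fits) (
  exec-seq (exec-compile (suc ∘ pos) l ρ _ fits) (
  exec-seq (exec-set _ _) (
  exec-seq (exec-repeat reversing {P = λ _ _ _ → ⊤} (λ _ → refl) (λ _ _ _ ())
              (λ _ _ _ → exec-set _ _) xs []) (
  exec-seq (exec-set _ _) (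
  exec-seq (exec-repeat folding (λ _ → refl) (λ _ _ _ ())
              (λ y ys zs →
                exec-seq (exec-set _ (folding (y ∷ ys) zs)) (
                exec-seq (exec-compile (bind pos) b (y ∷ value zs ∷ ρ) _ (fits-bind y ys zs))
                         (exec-set _ _)))
              (reverse xs) [])
  (exec-to (cong (λ ys → encode τ (value ys) ∙ s) (reverse-involutive xs)) (exec-set _ _))))))))
  where
  xs = ⟦ l ⟧ ρ
  value : List (Carrier σ) → Carrier τ
  value = foldr (λ x acc → ⟦ b ⟧ (x ∷ acc ∷ ρ)) (⟦ z ⟧ ρ)
  reversing folding : List (Carrier σ) → List (Carrier σ) → Tree
  reversing ys zs = encodes σ ys ∙ encodes σ zs ∙ encode τ (⟦ z ⟧ ρ) ∙ s
  folding ys zs = encodes σ ys ∙ encode τ (value zs) ∙ s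
  fits-bind : ∀ y ys zs → Fits (bind pos) (y ∷ value zs ∷ ρ) (encode σ y ∙ folding (y ∷ ys) zs)
  fits-bind y ys zs here              = refl
  fits-bind y ys zs (there here)      = refl
  fits-bind y ys zs (there (there x)) = fits x
exec-compile pos (retype t g eq) ρ s fits =
  exec-to (cong (_∙ s) (eq ρ)) (exec-compile pos t ρ s fits)
exec-compile* pos [] ρ s fits = exec-set X s
exec-compile* pos (_∷_ {Δ = Δ} a as) ρ s fits =
  exec-cond (λ { _ (oka , okas) → okas , oka }) (
  exec-seq (exec-compile* pos as ρ s fits)
           (exec-compile _ a ρ _ λ x → trans (nth-push (⟦ as ⟧* ρ) (pos x) s) (fits x)))

drops : ℕ → Tree → Tree
drops zero    s = s
drops (suc p) s = drops p (tail s)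

eval-drop : ∀ p e s → eval (drop p e) s ≡ drops p (eval e s)
eval-drop zero    e s = refl
eval-drop (suc p) e s = eval-drop p (tl e) s

drops-push : ∀ {Γ} (ρ : Env Γ) s → drops (length Γ) (push ρ s) ≡ s
drops-push []      s = refl
drops-push (v ∷ ρ) s = drops-push ρ s

position : ∀ {Γ} → Layout Γ
position here      = 0
position (there x) = suc (position x)

fits-position : ∀ {Γ} (ρ : Env Γ) s → Fits position ρ (push ρ s)
fits-position (v ∷ ρ) s here      = refl
fits-position (v ∷ ρ) s (there x) = fits-position ρ s x

-- Seals a term: callers rely on the specification `f` and the condition `C` alone. The last command
-- removes the arguments lying below the result.
function : ∀ {Δ τ} (t : Δ ⊢ τ) (f : Env Δ → Carrier τ) → (∀ ρ → ⟦ t ⟧ ρ ≡ f ρ) →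
           (C : ℕ → Env Δ → Set) → (∀ {N} ρ → 1 ≤ N → C N ρ → Affordable N t ρ) →
           Fun Δ τ
function {Δ} {τ} t f eq C afford = record
  { apply   = f
  ; Cond    = C
  ; program = compile position t ⨟ set (cons (hd X) (drop (suc (length Δ)) X))
  ; execute = λ ρ s →
      exec-cond (λ 1≤N ok → afford ρ 1≤N ok , tt) (
      exec-seq (exec-compile position t ρ _ (fits-position ρ s))
               (exec-to (cong₂ (λ v s′ → encode τ v ∙ s′) (eq ρ)
                          (trans (eval-drop (suc (length Δ)) X _) (drops-push ρ s)))
                        (exec-set _ _)))
  }

inline : ∀ {Δ τ} (e : Expr 1) (f : Env Δ → Carrier τ) →
             (∀ ρ s → eval e (push ρ s ∷ []) ≡ encode τ (f ρ) ∙ s) → Fun Δ τ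
inline e f eq = record
  { apply   = f
  ; Cond    = λ _ _ → ⊤
  ; program = set e
  ; execute = λ ρ s → exec-to (eq ρ s) (exec-set e _)
  }

-- Basic types, conditionals, arithmetic and list functions.

bool nat unit tree : Type
bool = type Bool encodeBool
nat  = type ℕ encodeℕ
unit = type ⊤ (λ _ → nil)
tree = type Tree id

pair : Type → Type → Type
pair σ τ = type (Carrier σ × Carrier τ) (λ (v , w) → encode σ v ∙ encode τ w)

fin : ℕ → Type
fin n = type (Fin n) (encodeℕ ∘ toℕ)

array : ℕ → Type → Type
array n τ = type (Fin n → Carrier τ) (λ f → encodeList (tabulate (encode τ ∘ f)))

-- As the types may depend on the instance, its data can be passed around as
-- values of singleton types.
the : (τ : Type) → Carrier τ → Type
the τ v = type ⊤ (λ _ → encode τ v)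

v0 : ∀ {α Γ} → α ∷ Γ ⊢ α
v0 = var here
v1 : ∀ {α β Γ} → α ∷ β ∷ Γ ⊢ β
v1 = var (there here)
v2 : ∀ {α β γ Γ} → α ∷ β ∷ γ ∷ Γ ⊢ γ
v2 = var (there (there here))
v3 : ∀ {α β γ δ Γ} → α ∷ β ∷ γ ∷ δ ∷ Γ ⊢ δ
v3 = var (there (there (there here)))
v4 : ∀ {α β γ δ ε Γ} → α ∷ β ∷ γ ∷ δ ∷ ε ∷ Γ ⊢ ε
v4 = var (there (there (there (there here))))
v5 : ∀ {α β γ δ ε ζ Γ} → α ∷ β ∷ γ ∷ δ ∷ ε ∷ ζ ∷ Γ ⊢ ζ
v5 = var (there (there (there (there (there here)))))

v6 : ∀ {α β γ δ ε ζ η Γ} → α ∷ β ∷ γ ∷ δ ∷ ε ∷ ζ ∷ η ∷ Γ ⊢ η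
v6 = var (there (there (there (there (there (there here))))))
v7 : ∀ {α β γ δ ε ζ η θ Γ} → α ∷ β ∷ γ ∷ δ ∷ ε ∷ ζ ∷ η ∷ θ ∷ Γ ⊢ θ
v7 = var (there (there (there (there (there (there (there here)))))))

zeroF : Fun [] nat
zeroF = inline (cons nil X) (λ _ → 0) λ { [] s → refl }

sucF predF : Fun (nat ∷ []) nat
sucF  = inline (cons (cons nil (hd X)) (tl X)) (λ { (m ∷ []) → suc m }) λ { (m ∷ []) s → refl }
predF = inline (cons (tl (hd X)) (tl X)) (λ { (m ∷ []) → pred m })
  λ { (zero ∷ []) s → refl ; (suc m ∷ []) s → refl }

falseF trueF : Fun [] bool
falseF = inline (cons nil X) (λ _ → false) λ { [] s → refl }
trueF  = inline (cons (cons nil nil) X) (λ _ → true) λ { [] s → refl }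

headF tailF : Fun (tree ∷ []) tree
headF = inline (cons (hd (hd X)) (tl X)) (λ { (t ∷ []) → head t }) λ { (t ∷ []) s → refl }
tailF = inline (cons (tl (hd X)) (tl X)) (λ { (t ∷ []) → tail t }) λ { (t ∷ []) s → refl }

nilF : ∀ {τ} → Fun [] (list τ)
nilF = inline (cons nil X) (λ _ → []) λ { [] s → refl }

join : Expr 1
join = cons (cons (hd X) (hd (tl X))) (tl (tl X))

consF : ∀ {τ} → Fun (τ ∷ list τ ∷ []) (list τ)
consF = inline join (λ { (x ∷ xs ∷ []) → x ∷ xs }) λ { (x ∷ xs ∷ []) s → refl }

pairF : ∀ {σ τ} → Fun (σ ∷ τ ∷ []) (pair σ τ)
pairF = inline join (λ { (v ∷ w ∷ []) → v , w }) λ { (v ∷ w ∷ []) s → refl }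

fstF : ∀ {σ τ} → Fun (pair σ τ ∷ []) σ
fstF = inline (cons (hd (hd X)) (tl X)) (λ { (p ∷ []) → proj₁ p }) λ { (p ∷ []) s → refl }

sndF : ∀ {σ τ} → Fun (pair σ τ ∷ []) τ
sndF = inline (cons (tl (hd X)) (tl X)) (λ { (p ∷ []) → proj₂ p }) λ { (p ∷ []) s → refl }

truth : Tree → Bool
truth nil     = false
truth (_ ∙ _) = true

-- A conditional is a loop that runs at most once. Both alternatives are already on the stack; the
-- round copies `v` over `w` and clears the guard, and then the two top slots are dropped.
selectF : ∀ {σ τ} (test : Carrier σ → Bool) → (∀ v → truth (encode σ v) ≡ test v) →
          Fun (σ ∷ τ ∷ τ ∷ []) τ
selectF {σ} {τ} test agree = record
  { apply   = λ { (c ∷ v ∷ w ∷ []) → if test c then v else w }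
  ; Cond    = λ _ _ → ⊤
  ; program = repeat (hd X) (set overwrite) ⨟ set (drop 2 X)
  ; execute = λ { (c ∷ v ∷ w ∷ []) s →
      exec-to (cong (λ b → encode τ (if b then v else w) ∙ s) (agree c))
        (branch (encode σ c) v w s) }
  }
  where
  overwrite : Expr 1
  overwrite = cons nil (cons (nthExpr 1 X) (cons (nthExpr 1 X) (drop 3 X)))
  branch : ∀ t v w s → Exec (repeat (hd X) (set overwrite) ⨟ set (drop 2 X))
    (t ∙ encode τ v ∙ encode τ w ∙ s) (encode τ (if truth t then v else w) ∙ s) Free
  branch nil v w s = exec-cond _ (exec-seq (exec-skip {c = set overwrite} refl) (exec-set _ _))
  branch (_ ∙ _) v w s =
    exec-cond _ (exec-seq (exec-once (λ ()) (exec-set _ _) refl) (exec-set _ _))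

selectᵇ : ∀ {τ} → Fun (bool ∷ τ ∷ τ ∷ []) τ
selectᵇ = selectF id λ { true → refl ; false → refl }

positive : ℕ → Bool
positive zero    = false
positive (suc _) = true

selectⁿ : ∀ {τ} → Fun (nat ∷ τ ∷ τ ∷ []) τ
selectⁿ = selectF positive λ { zero → refl ; (suc _) → refl }

nonempty : {A : Set} → List A → Bool
nonempty []      = false
nonempty (_ ∷ _) = true

selectˡ : ∀ {σ τ} → Fun (list σ ∷ τ ∷ τ ∷ []) τ
selectˡ = selectF nonempty λ { [] → refl ; (_ ∷ _) → refl }

foldr-∷ : ∀ {A B : Set} (f : A → B) xs ys → foldr (λ x acc → f x ∷ acc) ys xs ≡ map f xs ++ ys
foldr-∷ f []       ys = refl
foldr-∷ f (x ∷ xs) ys = cong (f x ∷_) (foldr-∷ f xs ys)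

encodes-units : ∀ m → encodes unit (replicate m tt) ≡ encodeℕ m
encodes-units zero    = refl
encodes-units (suc m) = cong (nil ∙_) (encodes-units m)

-- A number and the list of that many units have the same code, so folding over it is a counted
-- loop.
units : ∀ {Γ} → Γ ⊢ nat → Γ ⊢ list unit
units t = retype t (λ ρ → replicate (⟦ t ⟧ ρ) tt) (λ ρ → sym (encodes-units (⟦ t ⟧ ρ)))

times-affordable : ∀ {P : ⊤ → List ⊤ → Set} {N m} → m ≤ N → (∀ x xs → P x xs) →
                   length (replicate m tt) ≤ N × Suffixes P (replicate m tt)
times-affordable {m = m} m≤N p =
  ≤-trans (≤-reflexive (length-replicate m)) m≤N , suffixes-universal p (replicate m tt)

minusF : Fun (nat ∷ nat ∷ []) nat
minusF = function (fold (units v1) v0 (call predF (v1 ∷ [])))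
  (λ { (a ∷ b ∷ []) → a ∸ b }) (λ { (a ∷ b ∷ []) → correct a b })
  (λ { N (a ∷ b ∷ []) → b ≤ N })
  (λ { (a ∷ b ∷ []) _ b≤N → _ , _ , times-affordable b≤N _ })
  where
  correct : ∀ a b → foldr (λ _ → pred) a (replicate b tt) ≡ a ∸ b
  correct a zero    = refl
  correct a (suc b) = trans (cong pred (correct a b)) (pred[m∸n]≡m∸[1+n] a b)

addF : Fun (nat ∷ nat ∷ []) nat
addF = function (fold (units v1) v0 (call sucF (v1 ∷ [])))
  (λ { (a ∷ b ∷ []) → a + b }) (λ { (a ∷ b ∷ []) → correct a b })
  (λ { N (a ∷ b ∷ []) → b ≤ N })
  (λ { (a ∷ b ∷ []) _ b≤N → _ , _ , times-affordable b≤N _ })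
  where
  correct : ∀ a b → foldr (λ _ → suc) a (replicate b tt) ≡ a + b
  correct a zero    = sym (+-identityʳ a)
  correct a (suc b) = trans (cong suc (correct a b)) (sym (+-suc a b))

leq : ℕ → ℕ → Bool
leq a b = if positive (a ∸ b) then false else true

leq-reflects : ∀ a b → Reflects (a ≤ b) (leq a b)
leq-reflects zero    zero    = ofʸ z≤n
leq-reflects zero    (suc b) = ofʸ z≤n
leq-reflects (suc a) zero    = ofⁿ λ ()
leq-reflects (suc a) (suc b) with leq a b | leq-reflects a b
... | true  | ofʸ a≤b = ofʸ (s≤s a≤b)
... | false | ofⁿ a≰b = ofⁿ λ { (s≤s a≤b) → a≰b a≤b }

leqF : Fun (nat ∷ nat ∷ []) bool
leqF = function
  (call selectⁿ (call minusF (v0 ∷ v1 ∷ []) ∷ call falseF [] ∷ call trueF [] ∷ []))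
  (λ { (a ∷ b ∷ []) → leq a b }) (λ { (a ∷ b ∷ []) → refl })
  (λ { N (a ∷ b ∷ []) → b ≤ N }) (λ { (a ∷ b ∷ []) _ b≤N → (((_ , b≤N) , _) , _) })

minimum : ℕ → ℕ → ℕ
minimum a b = if leq a b then a else b

minimumF : Fun (nat ∷ nat ∷ []) nat
minimumF = function
  (call selectᵇ (call leqF (v0 ∷ v1 ∷ []) ∷ v0 ∷ v1 ∷ []))
  (λ { (a ∷ b ∷ []) → minimum a b }) (λ { (a ∷ b ∷ []) → refl })
  (λ { N (a ∷ b ∷ []) → b ≤ N }) (λ { (a ∷ b ∷ []) _ b≤N → (((_ , b≤N) , _) , _) })

toNat : ∀ {n Γ} → Γ ⊢ fin n → Γ ⊢ nat
toNat t = retype t (λ ρ → toℕ (⟦ t ⟧ ρ)) (λ _ → refl)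

-- The descent into the array goes through `tree`, because the tails of an array are not values of
-- the array type.
indexF : ∀ {n τ} → Fun (array n τ ∷ fin n ∷ []) τ
indexF {n} {τ} = function
  (retype (call headF
      (fold (units (toNat v1)) (retype v0 (λ ρ → encode (array n τ) (⟦ v0 ⟧ ρ)) (λ _ → refl))
        (call tailF (v1 ∷ [])) ∷ []))
    (λ ρ → ⟦ v0 ⟧ ρ (⟦ v1 ⟧ ρ)) (λ { (f ∷ i ∷ []) → correct f i }))
  (λ { (f ∷ i ∷ []) → f i }) (λ { (f ∷ i ∷ []) → refl })
  (λ N _ → n ≤ N)
  (λ { (f ∷ i ∷ []) _ n≤N →
    ((_ , _ , times-affordable (≤-trans (<⇒≤ (toℕ<n i)) n≤N) _) , _) , _ })
  where
  tails : Tree → ℕ → Tree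
  tails t k = foldr (λ _ → tail) t (replicate k tt)
  tails-suc : ∀ s t k → tails (s ∙ t) (suc k) ≡ tails t k
  tails-suc s t zero    = refl
  tails-suc s t (suc k) = cong tail (tails-suc s t k)
  correct : ∀ {n} (f : Fin n → Carrier τ) i →
            head (tails (encodeList (tabulate (encode τ ∘ f))) (toℕ i)) ≡ encode τ (f i)
  correct f zero    = refl
  correct f (suc i) = trans (cong head (tails-suc _ _ (toℕ i))) (correct (f ∘ suc) i)

appendF : ∀ {τ} → Fun (list τ ∷ list τ ∷ []) (list τ)
appendF = function (fold v0 v1 (call consF (v0 ∷ v1 ∷ [])))
  (λ { (xs ∷ ys ∷ []) → xs ++ ys }) (λ { (xs ∷ ys ∷ []) → correct xs ys })
  (λ { N (xs ∷ ys ∷ []) → length xs ≤ N })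
  (λ { (xs ∷ ys ∷ []) _ short → _ , _ , short , suffixes-universal _ xs })
  where
  correct : ∀ {A : Set} (xs ys : List A) → foldr _∷_ ys xs ≡ xs ++ ys
  correct []       ys = refl
  correct (x ∷ xs) ys = cong (x ∷_) (correct xs ys)

mapConsF : ∀ {τ} → Fun (τ ∷ list (list τ) ∷ []) (list (list τ))
mapConsF = function (fold v1 (call nilF []) (call consF (call consF (v2 ∷ v0 ∷ []) ∷ v1 ∷ [])))
  (λ { (x ∷ xss ∷ []) → map (x ∷_) xss }) (λ { (x ∷ xss ∷ []) → correct x xss })
  (λ { N (x ∷ xss ∷ []) → length xss ≤ N })
  (λ { (x ∷ xss ∷ []) _ short → _ , _ , short , suffixes-universal _ xss })
  where
  correct : ∀ {A : Set} (x : A) (xss : List (List A)) →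
            foldr {B = List (List A)} (λ xs acc → (x ∷ xs) ∷ acc) [] xss ≡ map (x ∷_) xss
  correct x []         = refl
  correct x (xs ∷ xss) = cong ((x ∷ xs) ∷_) (correct x xss)

-- The condition ⊥ waives the time bound: these serve only to compute the
-- parameter function, for which any running time will do.
mulF powF : Fun (nat ∷ nat ∷ []) nat
mulF = function (fold (units v1) (call zeroF []) (call addF (v2 ∷ v1 ∷ [])))
  (λ { (a ∷ b ∷ []) → b * a }) (λ { (a ∷ b ∷ []) → correct a b }) (λ _ _ → ⊥) (λ _ _ ())
  where
  correct : ∀ a b → foldr (λ _ acc → a + acc) 0 (replicate b tt) ≡ b * a
  correct a zero    = refl
  correct a (suc b) = cong (a +_) (correct a b)
powF = function (fold (units v1) (call sucF (call zeroF [] ∷ [])) (call mulF (v1 ∷ v2 ∷ [])))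
  (λ { (a ∷ b ∷ []) → a ^ b }) (λ { (a ∷ b ∷ []) → correct a b }) (λ _ _ → ⊥) (λ _ _ ())
  where
  correct : ∀ a b → foldr (λ _ acc → a * acc) 1 (replicate b tt) ≡ a ^ b
  correct a zero    = refl
  correct a (suc b) = cong (a *_) (correct a b)

-- Computability of the parameter function.

numeral : ∀ {Γ} → ℕ → Γ ⊢ nat
numeral zero    = call zeroF []
numeral (suc m) = call sucF (numeral m ∷ [])

numeral-value : ∀ {Γ} m (ρ : Env Γ) → ⟦ numeral m ⟧ ρ ≡ m
numeral-value zero    ρ = refl
numeral-value (suc m) ρ = cong suc (numeral-value m ρ)

alone : Code → Code
alone c = set (cons X nil) ⨟ c ⨟ set (hd X)

single : Code → Program
single c = record { extraVars = 0 ; body = command c }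

runs : ∀ {σ τ} (F : Fun (σ ∷ []) τ) v →
       Exec (alone (program F)) (encode σ v) (encode τ (apply F (v ∷ [])))
            (λ N → Cond F N (v ∷ []))
runs F v = exec-cond (λ _ ok → tt , ok , tt) (
  exec-seq (exec-set _ _) (exec-seq (execute F (v ∷ []) nil) (exec-set _ _)))

kernel : ℕ → ℕ → ℕ
kernel D k = suc (k * k * D)

-- The running time will be bounded by a constant times `N ^ e`, where `N` is the input size times
-- `B ^ B` and `B` is `kernel D k`; this is the share of the parameters in `N ^ e`.
fpt-bound : ℕ → ℕ → ℕ → ℕ
fpt-bound e D k = (kernel D k ^ kernel D k) ^ e

fpt-bound-computable : ∀ e → Computable₂ (fpt-bound e)
fpt-bound-computable e = single (alone (program F)) , λ D k →
  _ , record { final = _ ; halts = run (runs F (D , k)) ; outputs = refl }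
  where
  kernelF : Fun (nat ∷ nat ∷ []) nat
  kernelF = function (call sucF (call mulF (v0 ∷ call mulF (v1 ∷ v1 ∷ []) ∷ []) ∷ []))
    (λ { (D ∷ k ∷ []) → kernel D k }) (λ { (D ∷ k ∷ []) → refl }) (λ _ _ → ⊥) (λ _ _ ())
  selfPowF : Fun (nat ∷ []) nat
  selfPowF = function (call powF (v0 ∷ v0 ∷ []))
    (λ { (m ∷ []) → m ^ m }) (λ { (m ∷ []) → refl }) (λ _ _ → ⊥) (λ _ _ ())
  F : Fun (pair nat nat ∷ []) nat
  F = function
    (call powF
      (call selfPowF (call kernelF (call fstF (v0 ∷ []) ∷ call sndF (v0 ∷ []) ∷ []) ∷ []) ∷
       numeral e ∷ []))
    (λ { ((D , k) ∷ []) → fpt-bound e D k })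
    (λ { ((D , k) ∷ []) →
      cong ((kernel D k ^ kernel D k) ^_) (numeral-value e ((D , k) ∷ [])) })
    (λ _ _ → ⊥) (λ _ _ ())

-- The algorithm

module Algorithm (n : ℕ) (adj : Fin n → Fin n → Bool) (S : Fin n → Bool) where

  matrix : Type → Type
  matrix τ = array n (array n τ)

  -- The instance enters types, specifications and proofs, but the programs only receive it as
  -- input, so the code comes out the same for all `n`, `adj` and `S`.
  Range Adj Sel : Type
  Range = the (list (fin n)) (allFin n)
  Adj   = the (matrix bool) adj
  Sel   = the (array n bool) S

  open-the : ∀ {Γ τ v} → Γ ⊢ the τ v → Γ ⊢ τ
  open-the {v = v} t = retype t (λ _ → v) (λ _ → refl)

  adjF : Fun (Adj ∷ fin n ∷ fin n ∷ []) bool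
  adjF = function (call indexF (call indexF (open-the v0 ∷ v1 ∷ []) ∷ v2 ∷ []))
    (λ { (_ ∷ u ∷ v ∷ []) → adj u v }) (λ { (_ ∷ u ∷ v ∷ []) → refl })
    (λ N _ → n ≤ N) (λ { (_ ∷ u ∷ v ∷ []) _ n≤N → (((_ , n≤N) , _) , n≤N) })

  selF : Fun (Sel ∷ fin n ∷ []) bool
  selF = function (call indexF (open-the v0 ∷ v1 ∷ []))
    (λ { (_ ∷ v ∷ []) → S v }) (λ { (_ ∷ v ∷ []) → refl })
    (λ N _ → n ≤ N) (λ { (_ ∷ v ∷ []) _ n≤N → _ , n≤N })

  length-foldr-∷ : ∀ {A B : Set} (f : A → List B → B) xs →
                   length (foldr (λ x acc → f x acc ∷ acc) [] xs) ≡ length xs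
  length-foldr-∷ f []       = refl
  length-foldr-∷ f (x ∷ xs) = cong suc (length-foldr-∷ f xs)

  -- The input does not contain the number of vertices explicitly. They are enumerated along the
  -- characteristic vector: each further entry shifts the numbers found so far by one and puts 0 in
  -- front.
  rangeF : Fun (Sel ∷ []) Range
  rangeF = function
    (retype (fold (retype {τ = list bool} (open-the {τ = array n bool} {v = S} v0)
                    (λ _ → tabulate S) λ _ → cong encodeList (sym (map-tabulate S encodeBool)))
                  (call nilF [])
                  (call consF (call zeroF [] ∷
                     fold v1 (call nilF []) (call consF (call sucF (v0 ∷ []) ∷ v1 ∷ [])) ∷ [])))
            (λ _ → tt) (λ _ → cong encodeList (correct S)))
    (λ _ → tt) (λ _ → refl) (λ N _ → n ≤ N)
    (λ { {N} (_ ∷ []) _ n≤N → _ , _ , ≤-trans (≤-reflexive (length-tabulate S)) n≤N ,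
      suffixes-hereditary (λ xs → length xs ≤ N) (λ x xs → ≤-trans (n≤1+n _))
        (λ x xs short →
          (_ , (_ , _ , ≤-trans (≤-reflexive (length-upTo xs)) (≤-trans (n≤1+n _) short) ,
                suffixes-universal _ (upTo xs)) , _) , _)
        (tabulate S) (≤-trans (≤-reflexive (length-tabulate S)) n≤N) })
    where
    upTo : List Bool → List ℕ
    upTo = foldr (λ _ acc → 0 ∷ foldr (λ m acc → suc m ∷ acc) [] acc) []
    length-upTo : ∀ xs → length (upTo xs) ≡ length xs
    length-upTo []       = refl
    length-upTo (x ∷ xs) = cong suc (trans (length-foldr-∷ (λ m _ → suc m) (upTo xs)) (length-upTo xs))
    upTo-tabulate : ∀ {n} (f : Fin n → Bool) → upTo (tabulate f) ≡ tabulate toℕ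
    upTo-tabulate {zero}  f = refl
    upTo-tabulate {suc n} f = cong (0 ∷_) (begin
      foldr (λ m acc → suc m ∷ acc) [] (upTo (tabulate (f ∘ suc)))
        ≡⟨ foldr-∷ suc (upTo (tabulate (f ∘ suc))) [] ⟩
      map suc (upTo (tabulate (f ∘ suc))) ++ []
        ≡⟨ ++-identityʳ _ ⟩
      map suc (upTo (tabulate (f ∘ suc)))
        ≡⟨ cong (map suc) (upTo-tabulate (f ∘ suc)) ⟩
      map suc (tabulate toℕ)
        ≡⟨ map-tabulate toℕ suc ⟩
      tabulate (suc ∘ toℕ)
        ∎)
      where open ≡-Reasoning
    correct : ∀ {n} (f : Fin n → Bool) →
              map encodeℕ (upTo (tabulate f)) ≡ map (encodeℕ ∘ toℕ) (allFin n)
    correct {n} f = begin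
      map encodeℕ (upTo (tabulate f)) ≡⟨ cong (map encodeℕ) (upTo-tabulate f) ⟩
      map encodeℕ (tabulate toℕ) ≡⟨ map-tabulate toℕ encodeℕ ⟩
      tabulate (encodeℕ ∘ toℕ) ≡⟨ sym (map-tabulate id (encodeℕ ∘ toℕ)) ⟩
      map (encodeℕ ∘ toℕ) (allFin n) ∎
      where open ≡-Reasoning

  -- The fold makes its accumulator visible to `b`; `uniform` ensures that an entry depends on its
  -- index only.
  tab : ∀ {Γ τ} → Γ ⊢ Range → (b : fin n ∷ list τ ∷ Γ ⊢ τ) →
        (∀ i acc ρ → ⟦ b ⟧ (i ∷ acc ∷ ρ) ≡ ⟦ b ⟧ (i ∷ [] ∷ ρ)) → Γ ⊢ array n τ
  tab {τ = τ} r b uniform =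
    retype (fold (open-the {τ = list (fin n)} {v = allFin n} r)
                 (call nilF []) (call consF (b ∷ v1 ∷ [])))
           (λ ρ i → ⟦ b ⟧ (i ∷ [] ∷ ρ))
           (λ ρ → cong encodeList (begin
      map (encode τ) (foldr (λ i acc → ⟦ b ⟧ (i ∷ acc ∷ ρ) ∷ acc) [] (allFin n))
        ≡⟨ cong (map (encode τ))
             (foldr-cong (λ i acc → cong (_∷ acc) (uniform i acc ρ)) (refl {x = []}) (allFin n)) ⟩
      map (encode τ) (foldr (λ i acc → ⟦ b ⟧ (i ∷ [] ∷ ρ) ∷ acc) [] (allFin n))
        ≡⟨ cong (map (encode τ)) (foldr-∷ (λ i → ⟦ b ⟧ (i ∷ [] ∷ ρ)) (allFin n) []) ⟩
      map (encode τ) (map (λ i → ⟦ b ⟧ (i ∷ [] ∷ ρ)) (allFin n) ++ [])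
        ≡⟨ cong (map (encode τ)) (trans (++-identityʳ _) (map-tabulate id _)) ⟩
      map (encode τ) (tabulate (λ i → ⟦ b ⟧ (i ∷ [] ∷ ρ)))
        ≡⟨ map-tabulate _ (encode τ) ⟩
      tabulate (λ i → encode τ (⟦ b ⟧ (i ∷ [] ∷ ρ))) ∎))
    where open ≡-Reasoning

  length-range : ∀ {N} → n ≤ N → length (allFin n) ≤ N
  length-range = ≤-trans (≤-reflexive (length-tabulate id))

  -- A lower bound for the distance of v and u, exact if it is less than t.
  dist : ℕ → Fin n → Fin n → ℕ
  dist zero    v u = if adj v u then 1 else 0
  dist (suc t) v u =
    if (if leq (toℕ v) (toℕ u) then leq (toℕ u) (toℕ v) else false) then 0
    else suc (foldr (λ w m → if adj v w then minimum m (dist t w u) else m)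
                    (dist t v u) (allFin n))

  -- A matrix is denoted by the round `t` that produces it, while its tree stores all values of
  -- `dist t`. The meaning of a round is then just the successor.
  Mat : Type
  Mat = type ℕ (λ t → encode (matrix nat) (dist t))

  matF : Fun (Mat ∷ fin n ∷ fin n ∷ []) nat
  matF = function
    (call indexF
      (call indexF (retype v0 (λ ρ → dist (⟦ v0 ⟧ ρ)) (λ { (_ ∷ _) → refl }) ∷ v1 ∷ []) ∷
       v2 ∷ []))
    (λ { (t ∷ u ∷ v ∷ []) → dist t u v }) (λ { (_ ∷ u ∷ v ∷ []) → refl })
    (λ N _ → n ≤ N) (λ { (_ ∷ u ∷ v ∷ []) _ n≤N → (((_ , n≤N) , _) , n≤N) })

  entryF : Fun (Adj ∷ Range ∷ Mat ∷ fin n ∷ fin n ∷ []) nat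
  entryF = function
    (call selectᵇ
      (call selectᵇ
         (call leqF (toNat v3 ∷ toNat v4 ∷ []) ∷ call leqF (toNat v4 ∷ toNat v3 ∷ []) ∷
          call falseF [] ∷ []) ∷
       call zeroF [] ∷
       call sucF (fold (open-the v1) (call matF (v2 ∷ v3 ∷ v4 ∷ []))
         (call selectᵇ
            (call adjF (v2 ∷ v5 ∷ v0 ∷ []) ∷
             call minimumF (v1 ∷ call matF (v4 ∷ v0 ∷ v6 ∷ []) ∷ []) ∷
             v1 ∷ [])) ∷ []) ∷ []))
    (λ { (_ ∷ _ ∷ t ∷ v ∷ u ∷ []) → dist (suc t) v u })
    (λ { (_ ∷ _ ∷ t ∷ v ∷ u ∷ []) → refl })
    (λ { N (_ ∷ _ ∷ t ∷ v ∷ u ∷ []) → n ≤ N × (∀ v u → dist t v u ≤ N) })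
    (λ { (_ ∷ _ ∷ t ∷ v ∷ u ∷ []) _ (n≤N , d≤N) →
      let index≤N i = ≤-trans (<⇒≤ (toℕ<n i)) n≤N in
      let same   = ((_ , index≤N u) , (_ , index≤N v) , _) , _
          update = λ w → ((_ , n≤N) , ((_ , (_ , n≤N) , _) , d≤N w u) , _) , _
          least  = _ , (_ , n≤N) , length-range n≤N , suffixes-universal (λ w _ → update w) (allFin n)
      in (same , _ , ((least , _) , _) , _) , _ })

  Dist : Type
  Dist = the (matrix nat) (dist n)

  distanceF : Fun (Range ∷ Adj ∷ []) Dist
  distanceF = function
    (retype
      (fold (open-the {τ = list (fin n)} {v = allFin n} v0)
        -- `false` and `true` have the codes of 0 and 1, so the adjacency matrix already is the code
        -- of `dist 0`.
        (retype {τ = Mat} v1 (λ _ → 0) (λ _ → cong encodeList (tabulate-cong λ v →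
          cong encodeList (tabulate-cong λ u → encodeBool-ℕ (adj v u)))))
        (retype
          (tab v2 (tab v4 (call entryF (v7 ∷ v6 ∷ v5 ∷ v2 ∷ v0 ∷ [])) λ _ _ _ → refl)
               λ _ _ _ → refl)
          (λ { (_ ∷ t ∷ _) → suc t }) (λ { (_ ∷ t ∷ _ ∷ _ ∷ []) → refl })))
      -- There is one round per vertex, so the last matrix is that of `dist n`.
      (λ _ → tt) (λ { (_ ∷ _ ∷ []) → cong (encode Mat) {y = n}
        (trans (count (allFin n)) (length-tabulate id)) }))
    (λ _ → tt) (λ _ → refl)
    (λ N _ → n ≤ N × (∀ t v u → dist t v u ≤ N))
    (λ { (_ ∷ _ ∷ []) _ (n≤N , d≤N) → _ , _ , length-range n≤N ,
      suffixes-universal (λ _ xs →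
        let entry = λ i → _ , n≤N , d≤N (foldr (λ _ → suc) 0 xs)
            row   = λ i → _ , _ , length-range n≤N ,
                    suffixes-universal (λ j _ → (entry j , _ , _) , _) (allFin n)
        in _ , _ , length-range n≤N ,
           suffixes-universal (λ i _ → (row i , _ , _) , _) (allFin n)) (allFin n) })
    where
    encodeBool-ℕ : ∀ b → encodeBool b ≡ encodeℕ (if b then 1 else 0)
    encodeBool-ℕ true  = refl
    encodeBool-ℕ false = refl
    count : {A : Set} (xs : List A) → foldr (λ _ → suc) 0 xs ≡ length xs
    count []       = refl
    count (x ∷ xs) = cong suc (count xs)

  d : Fin n → Fin n → ℕ
  d = dist n

  dF : Fun (Dist ∷ fin n ∷ fin n ∷ []) nat
  dF = function (call indexF (call indexF (open-the v0 ∷ v1 ∷ []) ∷ v2 ∷ []))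
    (λ { (_ ∷ u ∷ v ∷ []) → d u v }) (λ { (_ ∷ u ∷ v ∷ []) → refl })
    (λ N _ → n ≤ N) (λ { (_ ∷ u ∷ v ∷ []) _ n≤N → (((_ , n≤N) , _) , n≤N) })

  inside outside : List (Fin n)
  inside  = foldr (λ x acc → if S x then x ∷ acc else acc) [] (allFin n)
  outside = foldr (λ x acc → if S x then acc else x ∷ acc) [] (allFin n)

  insideF outsideF : Fun (Range ∷ Sel ∷ []) (list (fin n))
  insideF = function
    (fold (open-the v0) (call nilF [])
      (call selectᵇ (call selF (v3 ∷ v0 ∷ []) ∷ call consF (v0 ∷ v1 ∷ []) ∷ v1 ∷ [])))
    (λ _ → inside) (λ { (_ ∷ _ ∷ []) → refl }) (λ N _ → n ≤ N)
    (λ { (_ ∷ _ ∷ []) _ n≤N → _ , _ , length-range n≤N ,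
       suffixes-universal (λ _ _ → ((_ , n≤N) , _) , _) (allFin n) })
  outsideF = function
    (fold (open-the v0) (call nilF [])
      (call selectᵇ (call selF (v3 ∷ v0 ∷ []) ∷ v1 ∷ call consF (v0 ∷ v1 ∷ []) ∷ [])))
    (λ _ → outside) (λ { (_ ∷ _ ∷ []) → refl }) (λ N _ → n ≤ N)
    (λ { (_ ∷ _ ∷ []) _ n≤N → _ , _ , length-range n≤N ,
       suffixes-universal (λ _ _ → ((_ , n≤N) , _) , _) (allFin n) })

  segment state : Type
  segment = pair (fin n) (fin n)
  state   = list segment

  Segment State : Set
  Segment = Carrier segment
  State   = Carrier state

  pairsOf : List (Fin n) → State
  pairsOf xs =
    foldr (λ a acc →
      foldr (λ b acc′ → if leq (suc (toℕ a)) (toℕ b) then (a , b) ∷ acc′ else acc′) acc xs) [] xs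

  pairsF : Fun (list (fin n) ∷ []) state
  pairsF = function
    (fold v0 (call nilF [])
      (fold v2 v1
        (call selectᵇ (call leqF (call sucF (toNat v2 ∷ []) ∷ toNat v0 ∷ []) ∷
                       call consF (call pairF (v2 ∷ v0 ∷ []) ∷ v1 ∷ []) ∷ v1 ∷ []))))
    (λ { (xs ∷ []) → pairsOf xs }) (λ { (xs ∷ []) → refl })
    (λ { N (xs ∷ []) → n ≤ N × length xs ≤ N })
    (λ { (xs ∷ []) _ (n≤N , short) → _ , _ , short ,
      suffixes-universal (λ a _ → _ , _ , short , suffixes-universal (λ b _ →
        ((_ , ≤-trans (<⇒≤ (toℕ<n b)) n≤N) , _) , _) xs) xs })

  tight : Fin n → Fin n → Fin n → Bool
  tight a x b = leq (d a x + d x b) (d a b)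

  tightF : Fun (Dist ∷ fin n ∷ fin n ∷ fin n ∷ []) bool
  tightF = function
    (call leqF (call addF (call dF (v0 ∷ v1 ∷ v2 ∷ []) ∷ call dF (v0 ∷ v2 ∷ v3 ∷ []) ∷ []) ∷
                call dF (v0 ∷ v1 ∷ v3 ∷ []) ∷ []))
    (λ { (_ ∷ a ∷ x ∷ b ∷ []) → tight a x b }) (λ { (_ ∷ a ∷ x ∷ b ∷ []) → refl })
    (λ N _ → n ≤ N × (∀ u v → d u v ≤ N))
    (λ { (_ ∷ a ∷ x ∷ b ∷ []) _ (n≤N , d≤N) →
      ((((_ , n≤N) , (_ , n≤N) , _) , d≤N x b) , (_ , n≤N) , _) , d≤N a b })

  splits : Fin n → State → List State
  splits x []            = []
  splits x ((a , b) ∷ σ) =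
    if tight a x b then ((a , x) ∷ (x , b) ∷ σ) ∷ map ((a , b) ∷_) (splits x σ)
    else map ((a , b) ∷_) (splits x σ)

  length-splits : ∀ x σ → length (splits x σ) ≤ length σ
  length-splits x []            = z≤n
  length-splits x ((a , b) ∷ σ) with tight a x b
  ... | true  = s≤s (≤-trans (≤-reflexive (length-map _ (splits x σ))) (length-splits x σ))
  ... | false = m≤n⇒m≤1+n (≤-trans (≤-reflexive (length-map _ (splits x σ))) (length-splits x σ))

  -- The recursion of `splits` also uses the tail of the state, which a fold does not supply; the
  -- fold therefore computes the pair of the tail and its splits.
  splitsF : Fun (Dist ∷ fin n ∷ state ∷ []) (list state)
  splitsF = function
    (call sndF
      (fold v2 (call pairF (call (nilF {segment}) [] ∷ call (nilF {state}) [] ∷ [])) step ∷ []))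
    (λ { (_ ∷ x ∷ σ ∷ []) → splits x σ })
    (λ { (_ ∷ x ∷ σ ∷ []) → cong proj₂ (scan≡ x σ) })
    (λ { N (_ ∷ x ∷ σ ∷ []) → n ≤ N × (∀ u v → d u v ≤ N) × length σ ≤ N })
    (λ { {N} (_ ∷ x ∷ σ ∷ []) _ (n≤N , d≤N , short) → ((_ , _ , short ,
      suffixes-hereditary (λ τ → length τ ≤ N) (λ _ _ → ≤-trans (n≤1+n _))
        (λ { s τ short′ →
          let results≤N = ≤-trans (≤-reflexive (cong (length ∘ proj₂) (scan≡ x τ)))
                                  (≤-trans (length-splits x τ) (≤-trans (n≤1+n _) short′))
              extended-ok = _ , results≤N
          in (_ , (((_ , n≤N , d≤N) , ((_ , extended-ok , _) , _) , extended-ok , _) , _) , _) , _ })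
        σ short) , _) , _ })
    where
    extended : segment ∷ pair state (list state) ∷ Dist ∷ fin n ∷ state ∷ [] ⊢ list state
    extended = call mapConsF (v0 ∷ call sndF (v1 ∷ []) ∷ [])
    step : segment ∷ pair state (list state) ∷ Dist ∷ fin n ∷ state ∷ [] ⊢ pair state (list state)
    step = call pairF
      (call consF (v0 ∷ call fstF (v1 ∷ []) ∷ []) ∷
       call selectᵇ
         (call tightF (v2 ∷ call fstF (v0 ∷ []) ∷ v3 ∷ call sndF (v0 ∷ []) ∷ []) ∷
          call consF
            (call consF
               (call pairF (call fstF (v0 ∷ []) ∷ v3 ∷ []) ∷
                call consF
                  (call pairF (v3 ∷ call sndF (v0 ∷ []) ∷ []) ∷ call fstF (v1 ∷ []) ∷ []) ∷ []) ∷
             extended ∷ []) ∷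
          extended ∷ []) ∷ [])
    scan : Fin n → State → State × List State
    scan x = foldr (λ { s acc → (s ∷ proj₁ acc) ,
      (if tight (proj₁ s) x (proj₂ s)
       then ((proj₁ s , x) ∷ (x , proj₂ s) ∷ proj₁ acc) ∷ map (s ∷_) (proj₂ acc)
       else map (s ∷_) (proj₂ acc)) }) ([] , [])
    scan≡ : ∀ x σ → scan x σ ≡ (σ , splits x σ)
    scan≡ x []            = refl
    scan≡ x ((a , b) ∷ σ) rewrite scan≡ x σ = refl

  refine : Fin n → List State → List State
  refine x = foldr (λ σ acc → splits x σ ++ acc) []

  explore : State → List (Fin n) → List State
  explore σ = foldr refine (σ ∷ [])

  -- Treating a vertex traverses the level reached from the vertices `ys` behind it in the list, so
  -- the bounds are asked of these levels.
  Small : ℕ → State → List (Fin n) → Set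
  Small N σ = Suffixes λ _ ys → length (explore σ ys) ≤ N × All (λ τ → length τ ≤ N) (explore σ ys)

  exploreF : Fun (Dist ∷ list (fin n) ∷ state ∷ []) (list state)
  exploreF = function
    (fold v1 (call consF (v2 ∷ call nilF [] ∷ []))
      (fold v1 (call nilF [])
        (call appendF (call splitsF (v4 ∷ v2 ∷ v0 ∷ []) ∷ v1 ∷ []))))
    (λ { (_ ∷ xs ∷ σ ∷ []) → explore σ xs }) (λ { (_ ∷ xs ∷ σ ∷ []) → refl })
    (λ { N (_ ∷ xs ∷ σ ∷ []) →
      n ≤ N × (∀ u v → d u v ≤ N) × length xs ≤ N × Small N σ xs })
    (λ { (_ ∷ xs ∷ σ ∷ []) _ (n≤N , d≤N , short , small) → _ , _ , short ,
      suffixes-map (λ { {x} {ys} (few , shorts) → _ , _ , few ,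
        suffixes-hereditary (All _) (λ { _ _ (_ ∷ ps) → ps })
          (λ { τ _ (p ∷ _) → ((_ , n≤N , d≤N , p) , _) , ≤-trans (length-splits x τ) p })
          (explore σ ys) shorts }) xs small })

  final : List State
  final = explore (pairsOf inside) outside

  answer : Bool
  answer = nonempty final

  Ample : ℕ → Set
  Ample N = n ≤ N × (∀ t u v → dist t u v ≤ N) × length outside ≤ N × length inside ≤ N ×
            Small N (pairsOf inside) outside

  input : Type
  input = pair (matrix bool) (array n bool)

  Input : Type
  Input = the input (adj , S)

  decideF : Fun (Input ∷ []) bool
  decideF = function
    (call answerF (adjT ∷ selT ∷ call rangeF (selT ∷ []) ∷ []))
    (λ _ → answer) (λ { (_ ∷ []) → refl })
    (λ N _ → Ample N)
    (λ { (_ ∷ []) _ ok → (_ , _ , (_ , proj₁ ok) , _) , ok })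
    where
    adjT : Input ∷ [] ⊢ Adj
    adjT = retype (call fstF (open-the {τ = input} {v = adj , S} v0 ∷ []))
             (λ _ → tt) (λ _ → refl)
    selT : Input ∷ [] ⊢ Sel
    selT = retype (call sndF (open-the {τ = input} {v = adj , S} v0 ∷ []))
             (λ _ → tt) (λ _ → refl)
    answerF : Fun (Adj ∷ Sel ∷ Range ∷ []) bool
    answerF = function
      (call selectˡ
        (call exploreF
           (call distanceF (v2 ∷ v0 ∷ []) ∷ call outsideF (v2 ∷ v1 ∷ []) ∷
            call pairsF (call insideF (v2 ∷ v1 ∷ []) ∷ []) ∷ []) ∷
         call trueF [] ∷ call falseF [] ∷ []))
      (λ _ → answer) (λ { (_ ∷ _ ∷ _ ∷ []) → correct final })
      (λ N _ → Ample N)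
      (λ { (_ ∷ _ ∷ _ ∷ []) _ (n≤N , dist≤N , out≤N , in≤N , small) →
        ((((_ , n≤N , dist≤N) , (_ , n≤N) , (((_ , n≤N) , _) , n≤N , in≤N) , _) ,
          n≤N , dist≤N n , out≤N , small) , _) , _ })
      where
      correct : ∀ {A : Set} (xs : List A) → (if nonempty xs then true else false) ≡ nonempty xs
      correct []      = refl
      correct (_ ∷ _) = refl

-- Distances and geodesics

minimum-≤ˡ : ∀ a b → minimum a b ≤ a
minimum-≤ˡ a b with leq a b | leq-reflects a b
... | true  | ofʸ _   = ≤-refl
... | false | ofⁿ a≰b = <⇒≤ (≰⇒> a≰b)

minimum-≤ʳ : ∀ a b → minimum a b ≤ b
minimum-≤ʳ a b with leq a b | leq-reflects a b
... | true  | ofʸ a≤b = a≤b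
... | false | ofⁿ _   = ≤-refl

minimum-sel : ∀ a b → minimum a b ≡ a ⊎ minimum a b ≡ b
minimum-sel a b with leq a b
... | true  = inj₁ refl
... | false = inj₂ refl

module _ {A : Set} (p : A → Bool) (f : A → ℕ) (m : ℕ) where

  least : List A → ℕ
  least = foldr (λ w acc → if p w then minimum acc (f w) else acc) m

  least-≤ : ∀ {x xs} → x ∈ xs → T (p x) → least xs ≤ f x
  least-≤ {xs = y ∷ xs} (here refl) px with p y
  ... | true  = minimum-≤ʳ (least xs) (f y)
  least-≤ {xs = y ∷ xs} (there x∈xs) px with p y
  ... | true  = ≤-trans (minimum-≤ˡ (least xs) (f y)) (least-≤ x∈xs px)
  ... | false = least-≤ x∈xs px

  least-sel : ∀ xs → least xs ≡ m ⊎ ∃[ x ] T (p x) × least xs ≡ f x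
  least-sel []       = inj₁ refl
  least-sel (y ∷ xs) with p y in py
  ... | false = least-sel xs
  ... | true with minimum-sel (least xs) (f y)
  ...   | inj₂ eq = inj₂ (y , subst T (sym py) tt , eq)
  ...   | inj₁ eq rewrite eq = least-sel xs

unique-lookup : ∀ {A : Set} {xs : List A} → Unique xs →
                ∀ i j → List.lookup xs i ≡ List.lookup xs j → i ≡ j
unique-lookup (x∉ ∷ u) zero    zero    eq = refl
unique-lookup (x∉ ∷ u) zero    (suc j) eq = contradiction eq (All.lookup x∉ (∈-lookup j))
unique-lookup (x∉ ∷ u) (suc i) zero    eq = contradiction (sym eq) (All.lookup x∉ (∈-lookup i))
unique-lookup (x∉ ∷ u) (suc i) (suc j) eq = cong suc (unique-lookup u i j eq)

-- Pigeonhole principle: without repetitions, looking up positions is an injection into `Fin n`.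
length-unique : ∀ {n} {xs : List (Fin n)} → Unique xs → length xs ≤ n
length-unique u = injective⇒≤ (λ {i} {j} → unique-lookup u i j)

module Distances (G : Graph) (connected : Graph.Connected G) (S : Fin (Graph.order G) → Bool) where

  open Graph G hiding (Vertex)
  open Algorithm order adj S using (dist; d)

  V : Set
  V = Fin order

  same : V → V → Bool
  same v u = if leq (toℕ v) (toℕ u) then leq (toℕ u) (toℕ v) else false

  same-reflects : ∀ v u → Reflects (v ≡ u) (same v u)
  same-reflects v u with leq (toℕ v) (toℕ u) | leq-reflects (toℕ v) (toℕ u)
  ... | false | ofⁿ v≰u = ofⁿ λ { refl → v≰u ≤-refl }
  ... | true  | ofʸ v≤u with leq (toℕ u) (toℕ v) | leq-reflects (toℕ u) (toℕ v)
  ...   | true  | ofʸ u≤v = ofʸ (toℕ-injective (≤-antisym v≤u u≤v))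
  ...   | false | ofⁿ u≰v = ofⁿ λ { refl → u≰v ≤-refl }

  dist-≤-walk : ∀ t {v u} (w : Walk v u) → dist t v u ≤ walkLength w
  dist-≤-walk zero    (stop v) rewrite adj-irrefl v = z≤n
  dist-≤-walk zero    {u = u} (step v e w) with adj v u
  ... | true  = s≤s z≤n
  ... | false = z≤n
  dist-≤-walk (suc t) (stop v) with same v v | same-reflects v v
  ... | true  | _       = z≤n
  ... | false | ofⁿ v≢v = contradiction refl v≢v
  dist-≤-walk (suc t) {u = u} (step v {x} e w) with same v u
  ... | true  = z≤n
  ... | false = s≤s (≤-trans
    (least-≤ (adj v) (λ x → dist t x u) (dist t v u) (∈-allFin x) e) (dist-≤-walk t w))

  Within : V → V → ℕ → Set
  Within v u m = Σ[ w ∈ Walk v u ] walkLength w ≤ m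

  -- Every round adds one unless the ends coincide, so a value that no walk attains has grown to at
  -- least `t`.
  dist-attained : ∀ t v u → t ≤ dist t v u ⊎ Within v u (dist t v u)
  dist-attained zero    v u = inj₁ z≤n
  dist-attained (suc t) v u with same v u | same-reflects v u
  ... | true  | ofʸ refl = inj₂ (stop v , z≤n)
  ... | false | _ with least-sel (adj v) (λ x → dist t x u) (dist t v u) (allFin order)
  -- Here the minimum is its default `dist t v u`; a walk within that bound is also within its
  -- successor.
  ...   | inj₁ eq rewrite eq with dist-attained t v u
  ...     | inj₁ t≤      = inj₁ (s≤s t≤)
  ...     | inj₂ (w , l) = inj₂ (w , m≤n⇒m≤1+n l)
  dist-attained (suc t) v u | false | _ | inj₂ (x , e , eq) rewrite eq with dist-attained t x u
  ...     | inj₁ t≤      = inj₁ (s≤s t≤)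
  ...     | inj₂ (w , l) = inj₂ (step v e w , s≤s l)

  length-vertices : ∀ {v u} (w : Walk v u) → length (walkVertices w) ≡ suc (walkLength w)
  length-vertices (stop v)     = refl
  length-vertices (step v _ w) = cong suc (length-vertices w)

  path-length<order : ∀ {v u} (P : Path v u) → Path.length P < order
  path-length<order P = ≤-trans (≤-reflexive (sym (length-vertices (Path.walk P))))
                                (length-unique (Path.simple P))

  dist<order : ∀ t v u → dist t v u < order
  dist<order t v u =
    ≤-<-trans (dist-≤-walk t (Path.walk (connected v u))) (path-length<order (connected v u))

  -- Simplicity is left out, so that walks can be cut and joined freely; `geodesic-unique` recovers
  -- it.
  Geodesic : V → V → Set
  Geodesic v u = Within v u (d v u)

  d-≤ : ∀ {v u} (w : Walk v u) → d v u ≤ walkLength w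
  d-≤ = dist-≤-walk order

  geodesic : ∀ v u → Geodesic v u
  geodesic v u with dist-attained order v u
  ... | inj₂ w = w
  -- After `order` rounds the lower bound is exact, as a path has fewer than `order` edges.
  ... | inj₁ n≤d = contradiction (<-≤-trans (dist<order order v u) n≤d) (<-irrefl refl)

  d-positive : ∀ {v u} → v ≢ u → 1 ≤ d v u
  d-positive {v} {u} v≢u with geodesic v u
  ... | stop _     , _ = contradiction refl v≢u
  ... | step _ _ w , l = ≤-trans (s≤s z≤n) l

  infixr 5 _⊕_

  _⊕_ : ∀ {a x b} → Walk a x → Walk x b → Walk a b
  stop _     ⊕ w′ = w′
  step a e w ⊕ w′ = step a e (w ⊕ w′)

  length-⊕ : ∀ {a x b} (w : Walk a x) (w′ : Walk x b) →
             walkLength (w ⊕ w′) ≡ walkLength w + walkLength w′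
  length-⊕ (stop _)     w′ = refl
  length-⊕ (step a e w) w′ = cong suc (length-⊕ w w′)

  triangle : ∀ a x b → d a b ≤ d a x + d x b
  triangle a x b with geodesic a x | geodesic x b
  ... | w , l | w′ , l′ = ≤-trans (d-≤ (w ⊕ w′))
    (≤-trans (≤-reflexive (length-⊕ w w′)) (+-mono-≤ l l′))

  start∈ : ∀ {a b} (w : Walk a b) → a ∈ walkVertices w
  start∈ (stop _)     = here refl
  start∈ (step _ _ _) = here refl

  ∈-⊕ˡ : ∀ {a x b y} (w : Walk a x) (w′ : Walk x b) →
         y ∈ walkVertices w → y ∈ walkVertices (w ⊕ w′)
  ∈-⊕ˡ (stop _)     w′ (here refl) = start∈ w′
  ∈-⊕ˡ (step a e w) w′ (here refl) = here refl
  ∈-⊕ˡ (step a e w) w′ (there y∈w) = there (∈-⊕ˡ w w′ y∈w)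

  ∈-⊕ʳ : ∀ {a x b y} (w : Walk a x) (w′ : Walk x b) →
         y ∈ walkVertices w′ → y ∈ walkVertices (w ⊕ w′)
  ∈-⊕ʳ (stop _)     w′ y∈w′ = y∈w′
  ∈-⊕ʳ (step a e w) w′ y∈w′ = there (∈-⊕ʳ w w′ y∈w′)

  record Cut {a b} (w : Walk a b) (x : V) : Set where
    constructor cut
    field
      before  : Walk a x
      after   : Walk x b
      lengths : walkLength before + walkLength after ≡ walkLength w
      visits  : ∀ {y} → y ∈ walkVertices w → y ∈ walkVertices before ⊎ y ∈ walkVertices after

  cutAt : ∀ {a b x} (w : Walk a b) → x ∈ walkVertices w → Cut w x
  cutAt (stop _)     (here refl) = cut (stop _) (stop _) refl inj₁
  cutAt (step a e w) (here refl) = cut (stop a) (step a e w) refl inj₂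
  cutAt (step a e w) (there x∈w) with cutAt w x∈w
  ... | cut w₁ w₂ eq vis = cut (step a e w₁) w₂ (cong suc eq) λ
    { (here refl) → inj₁ (here refl)
    ; (there y∈w) → map₁ there (vis y∈w) }

  -- If the start occurred again, the part after that occurrence would be a walk shorter than the
  -- distance. Removing the first edge lowers the distance to `b` by at most one, so the rest is a
  -- geodesic again.
  geodesic-unique : ∀ {a b} (w : Walk a b) → walkLength w ≤ d a b → Unique (walkVertices w)
  geodesic-unique (stop _) _ = [] ∷ []
  geodesic-unique {b = b} (step a {x} e w) l =
    ¬Any⇒All¬ _ (λ a∈w → let open Cut (cutAt w a∈w) in
      <-irrefl refl (≤-<-trans (d-≤ after)
        (≤-trans (s≤s (≤-trans (m≤n+m _ (walkLength before)) (≤-reflexive lengths))) l)))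
    ∷ geodesic-unique w (s≤s⁻¹ (≤-trans l shorter))
    where
    shorter : d a b ≤ suc (d x b)
    shorter with geodesic x b
    ... | w′ , l′ = ≤-trans (d-≤ (step a e w′)) (s≤s l′)

  geodesic⇒shortestPath : ∀ {a b} → Geodesic a b → ShortestPath a b
  geodesic⇒shortestPath (w , l) = record
    { path     = record { walk = w ; simple = geodesic-unique w l }
    ; shortest = λ Q → ≤-trans l (d-≤ (Path.walk Q))
    }

  shortestPath⇒geodesic : ∀ {a b} → ShortestPath a b → Geodesic a b
  shortestPath⇒geodesic {a} {b} P = ShortestPath.walk P ,
    ≤-trans (ShortestPath.shortest P (ShortestPath.path Q)) (proj₂ (geodesic a b))
    where Q = geodesic⇒shortestPath (geodesic a b)

  d-≤-diameter : ∀ {D} → IsDiameter D → ∀ a b → d a b ≤ D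
  d-≤-diameter (_ , greatest) a b = ≤-trans (d-≤ (ShortestPath.walk P)) (greatest a b _ (P , refl))
    where P = geodesic⇒shortestPath (geodesic a b)

-- Correctness of the search

length-filter-tabulate : ∀ {A : Set} {n} (S : Subset n) (p : A → Bool) (f : Fin n → A) →
  (∀ i → p (f i) ≡ lookup S i) →
  length (filter (λ x → p x Bool.≟ true) (tabulate f)) ≡ ∣ S ∣
length-filter-tabulate []          p f eq = refl
length-filter-tabulate (true ∷ S)  p f eq rewrite eq zero =
  cong suc (length-filter-tabulate S p (f ∘ suc) (eq ∘ suc))
length-filter-tabulate (false ∷ S) p f eq rewrite eq zero =
  length-filter-tabulate S p (f ∘ suc) (eq ∘ suc)

length-cartesianProduct : ∀ {A B : Set} (xs : List A) (ys : List B) →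
  length (cartesianProduct xs ys) ≡ length xs * length ys
length-cartesianProduct []       ys = refl
length-cartesianProduct (x ∷ xs) ys = trans (length-++ (map (x ,_) ys))
  (cong₂ _+_ (length-map (x ,_) ys) (length-cartesianProduct xs ys))

lookup-tabulate : ∀ {A : Set} {P : A → Set} {xs : List A}
                  (f : ∀ {x} → x ∈ xs → P x) {x} (m : x ∈ xs) →
                  All.lookup (All.tabulate f) m ≡ f m
lookup-tabulate f (here refl) = refl
lookup-tabulate f (there m)   = lookup-tabulate (f ∘ there) m

module Search (G : Graph) (connected : Graph.Connected G) (S : Subset (Graph.order G)) where

  open Graph G hiding (Vertex)
  open Algorithm order adj (lookup S)
  open Distances G connected (lookup S)

  lt : Segment → Bool
  lt (a , b) = leq (suc (toℕ a)) (toℕ b)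

  -- Rewriting the folds of the program as filters gives membership, uniqueness and length at once.
  inside≡filter : inside ≡ filter (λ x → lookup S x Bool.≟ true) (allFin order)
  inside≡filter = helper (allFin order)
    where
    helper : ∀ xs → foldr (λ x acc → if lookup S x then x ∷ acc else acc) [] xs
                    ≡ filter (λ x → lookup S x Bool.≟ true) xs
    helper []       = refl
    helper (x ∷ xs) with lookup S x
    ... | true  = cong (x ∷_) (helper xs)
    ... | false = helper xs

  outside≡filter : outside ≡ filter (λ x → lookup S x Bool.≟ false) (allFin order)
  outside≡filter = helper (allFin order)
    where
    helper : ∀ xs → foldr (λ x acc → if lookup S x then acc else x ∷ acc) [] xs
                    ≡ filter (λ x → lookup S x Bool.≟ false) xs
    helper []       = refl
    helper (x ∷ xs) with lookup S x
    ... | true  = helper xs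
    ... | false = cong (x ∷_) (helper xs)

  ∈-inside⁻ : ∀ {x} → x ∈ inside → x ∈ₛ S
  ∈-inside⁻ x∈ = lookup⇒[]= _ S
    (proj₂ (∈-filter⁻ (λ x → lookup S x Bool.≟ true) {xs = allFin order}
                      (subst (_ ∈_) inside≡filter x∈)))

  ∈-inside⁺ : ∀ {x} → x ∈ₛ S → x ∈ inside
  ∈-inside⁺ x∈ = subst (_ ∈_) (sym inside≡filter)
    (∈-filter⁺ (λ x → lookup S x Bool.≟ true) (∈-allFin _) ([]=⇒lookup x∈))

  ∈-outside⁻ : ∀ {x} → x ∈ outside → x ∉ₛ S
  ∈-outside⁻ x∈ x∈S with trans (sym ([]=⇒lookup x∈S))
    (proj₂ (∈-filter⁻ (λ x → lookup S x Bool.≟ false) {xs = allFin order}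
                      (subst (_ ∈_) outside≡filter x∈)))
  ... | ()

  ∈-outside⁺ : ∀ {x} → x ∉ₛ S → x ∈ outside
  ∈-outside⁺ {x} x∉ = subst (_ ∈_) (sym outside≡filter)
    (∈-filter⁺ (λ x → lookup S x Bool.≟ false) (∈-allFin _) (excluded (lookup S x) refl))
    where
    excluded : ∀ b → lookup S x ≡ b → lookup S x ≡ false
    excluded false eq = eq
    excluded true  eq = contradiction (lookup⇒[]= x S eq) x∉

  unique-inside : Unique inside
  unique-inside = subst Unique (sym inside≡filter) (filter⁺ _ (allFin⁺ order))

  unique-outside : Unique outside
  unique-outside = subst Unique (sym outside≡filter) (filter⁺ _ (allFin⁺ order))

  pairs : State
  pairs = pairsOf inside

  pairs≡filter : pairs ≡ filter (λ s → lt s Bool.≟ true) (cartesianProduct inside inside)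
  pairs≡filter = outer inside inside
    where
    open ≡-Reasoning
    inner : ∀ a ys acc → foldr (λ b acc′ → if lt (a , b) then (a , b) ∷ acc′ else acc′) acc ys
                         ≡ filter (λ s → lt s Bool.≟ true) (map (a ,_) ys) ++ acc
    inner a []       acc = refl
    inner a (b ∷ ys) acc with lt (a , b)
    ... | true  = cong ((a , b) ∷_) (inner a ys acc)
    ... | false = inner a ys acc
    outer : ∀ xs ys →
      foldr (λ a acc → foldr (λ b acc′ → if lt (a , b) then (a , b) ∷ acc′ else acc′) acc ys) [] xs
      ≡ filter (λ s → lt s Bool.≟ true) (cartesianProduct xs ys)
    outer []       ys = refl
    outer (a ∷ xs) ys = trans (inner a ys _)
      (trans (cong (filter (λ s → lt s Bool.≟ true) (map (a ,_) ys) ++_) (outer xs ys))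
             (sym (filter-++ (λ s → lt s Bool.≟ true) (map (a ,_) ys) (cartesianProduct xs ys))))

  ∈-pairs⁻ : ∀ {a b} → (a , b) ∈ pairs → a ∈ₛ S × b ∈ₛ S × toℕ a < toℕ b
  ∈-pairs⁻ {a} {b} m with ∈-filter⁻ (λ s → lt s Bool.≟ true) {xs = cartesianProduct inside inside}
                            (subst (_ ∈_) pairs≡filter m)
  ... | m′ , eq with ∈-cartesianProduct⁻ inside inside m′ | lt (a , b) | leq-reflects (suc (toℕ a)) (toℕ b)
  ...   | a∈ , b∈ | true  | ofʸ a<b = ∈-inside⁻ a∈ , ∈-inside⁻ b∈ , a<b
  ∈-pairs⁻ m | m′ , () | a∈ , b∈ | false | _

  ∈-pairs⁺ : ∀ {a b} → a ∈ₛ S → b ∈ₛ S → toℕ a < toℕ b → (a , b) ∈ pairs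
  ∈-pairs⁺ {a} {b} a∈ b∈ a<b = subst (_ ∈_) (sym pairs≡filter)
    (∈-filter⁺ (λ s → lt s Bool.≟ true)
      (∈-cartesianProduct⁺ (∈-inside⁺ a∈) (∈-inside⁺ b∈)) lt-true)
    where
    lt-true : lt (a , b) ≡ true
    lt-true with lt (a , b) | leq-reflects (suc (toℕ a)) (toℕ b)
    ... | true  | _       = refl
    ... | false | ofⁿ a≮b = contradiction a<b a≮b

  unique-pairs : Unique pairs
  unique-pairs = subst Unique (sym pairs≡filter)
    (filter⁺ _ (cartesianProduct⁺ unique-inside unique-inside))

  length-inside : length inside ≡ ∣ S ∣
  length-inside = trans (cong length inside≡filter)
    (length-filter-tabulate S (lookup S) id (λ _ → refl))

  length-pairs : length pairs ≤ ∣ S ∣ * ∣ S ∣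
  length-pairs = ≤-trans (≤-reflexive (cong length pairs≡filter)) (≤-trans
    (length-filter (λ s → lt s Bool.≟ true) (cartesianProduct inside inside))
    (≤-reflexive (trans (length-cartesianProduct inside inside) (cong₂ _*_ length-inside length-inside))))

  -- By the triangle inequality the condition in `here` is an equality, that is, `x` lies on some
  -- geodesic from `a` to `b`.
  data Split (x : V) : State → State → Set where
    here  : ∀ {a b σ} → d a x + d x b ≤ d a b → Split x ((a , b) ∷ σ) ((a , x) ∷ (x , b) ∷ σ)
    there : ∀ {s σ τ} → Split x σ τ → Split x (s ∷ σ) (s ∷ τ)

  ∈-splits⁻ : ∀ x σ {τ} → τ ∈ splits x σ → Split x σ τ
  ∈-splits⁻ x ((a , b) ∷ σ) τ∈ with tight a x b | leq-reflects (d a x + d x b) (d a b)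
  ∈-splits⁻ x ((a , b) ∷ σ) (here refl) | true | ofʸ t = here t
  ∈-splits⁻ x ((a , b) ∷ σ) (there τ∈)  | true | _ with ∈-map⁻ _ τ∈
  ... | _ , τ∈′ , refl = there (∈-splits⁻ x σ τ∈′)
  ∈-splits⁻ x ((a , b) ∷ σ) τ∈ | false | _ with ∈-map⁻ _ τ∈
  ... | _ , τ∈′ , refl = there (∈-splits⁻ x σ τ∈′)

  ∈-splits⁺ : ∀ {x σ τ} → Split x σ τ → τ ∈ splits x σ
  ∈-splits⁺ {x} (here {a} {b} t) with tight a x b | leq-reflects (d a x + d x b) (d a b)
  ... | true  | _      = here refl
  ... | false | ofⁿ ¬t = contradiction t ¬t
  ∈-splits⁺ {x} (there {a , b} p) with tight a x b
  ... | true  = there (∈-map⁺ _ (∈-splits⁺ p))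
  ... | false = ∈-map⁺ _ (∈-splits⁺ p)

  ∈-refine⁻ : ∀ x L {τ} → τ ∈ refine x L → ∃[ σ ] σ ∈ L × Split x σ τ
  ∈-refine⁻ x (σ ∷ L) τ∈ with ∈-++⁻ (splits x σ) τ∈
  ... | inj₁ τ∈′ = σ , here refl , ∈-splits⁻ x σ τ∈′
  ... | inj₂ τ∈′ with ∈-refine⁻ x L τ∈′
  ...   | σ′ , σ′∈ , p = σ′ , there σ′∈ , p

  ∈-refine⁺ : ∀ {x L σ τ} → σ ∈ L → Split x σ τ → τ ∈ refine x L
  ∈-refine⁺ (here refl) p = ∈-++⁺ˡ (∈-splits⁺ p)
  ∈-refine⁺ {x} {σ ∷ _} (there σ∈) p = ∈-++⁺ʳ (splits x σ) (∈-refine⁺ σ∈ p)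

  System : State → Set
  System = All λ (a , b) → Geodesic a b

  Covers : ∀ {σ} → System σ → V → Set
  Covers []             x = ⊥
  Covers ((w , _) ∷ ws) x = x ∈ walkVertices w ⊎ Covers ws x

  -- The walk through `x` is cut there. Each piece is at least as long as the distance of its ends,
  -- and together they have length at most `d a b`, hence at most the sum of these distances; so
  -- both are geodesics.
  divide : ∀ {σ x} (ws : System σ) → Covers ws x →
           ∃[ τ ] Split x σ τ × Σ[ ws′ ∈ System τ ] (∀ {y} → Covers ws y → Covers ws′ y)
  divide {(a , b) ∷ σ} {x} ((w , l) ∷ ws) (inj₁ x∈w) with cutAt w x∈w
  ... | cut w₁ w₂ eq visits = _ , here split≤ , (w₁ , l₁) ∷ (w₂ , l₂) ∷ ws , λ
    { (inj₁ y∈w)  → [ inj₁ , inj₂ ∘ inj₁ ]′ (visits y∈w)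
    ; (inj₂ y∈ws) → inj₂ (inj₂ y∈ws) }
    where
    total : walkLength w₁ + walkLength w₂ ≤ d a b
    total = ≤-trans (≤-reflexive eq) l
    split≤ : d a x + d x b ≤ d a b
    split≤ = ≤-trans (+-mono-≤ (d-≤ w₁) (d-≤ w₂)) total
    l₁ : walkLength w₁ ≤ d a x
    l₁ = +-cancelʳ-≤ (d x b) _ _ (≤-trans (+-monoʳ-≤ _ (d-≤ w₂)) (≤-trans total (triangle a x b)))
    l₂ : walkLength w₂ ≤ d x b
    l₂ = +-cancelˡ-≤ (d a x) _ _ (≤-trans (+-monoˡ-≤ _ (d-≤ w₁)) (≤-trans total (triangle a x b)))
  divide (w ∷ ws) (inj₂ c) with divide ws c
  ... | τ , p , ws′ , f = _ , there p , w ∷ ws′ , λ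
    { (inj₁ y∈w) → inj₁ y∈w ; (inj₂ y∈ws) → inj₂ (f y∈ws) }

  -- The two halves are joined at `x`; the inequality stored in `here` makes the result a geodesic.
  merge : ∀ {σ τ x} → Split x σ τ → (ws : System τ) →
          Σ[ ws′ ∈ System σ ] Covers ws′ x × (∀ {y} → Covers ws y → Covers ws′ y)
  merge (here t) ((w₁ , l₁) ∷ (w₂ , l₂) ∷ ws) =
    (w₁ ⊕ w₂ , ≤-trans (≤-reflexive (length-⊕ w₁ w₂)) (≤-trans (+-mono-≤ l₁ l₂) t)) ∷ ws ,
    inj₁ (∈-⊕ʳ w₁ w₂ (start∈ w₂)) , λ
    { (inj₁ y∈)        → inj₁ (∈-⊕ˡ w₁ w₂ y∈)
    ; (inj₂ (inj₁ y∈)) → inj₁ (∈-⊕ʳ w₁ w₂ y∈)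
    ; (inj₂ (inj₂ y∈)) → inj₂ y∈ }
  merge (there p) (w ∷ ws) with merge p ws
  ... | ws′ , c , f = w ∷ ws′ , inj₂ c , λ
    { (inj₁ y∈w) → inj₁ y∈w ; (inj₂ y∈ws) → inj₂ (f y∈ws) }

  -- The splits are undone one by one. Each merge puts its vertex on a walk and keeps everything
  -- covered so far.
  explore-sound : ∀ {ρ} xs {σ} → σ ∈ explore ρ xs → (ws : System σ) →
    Σ[ ws′ ∈ System ρ ] (∀ {y} → y ∈ xs ⊎ Covers ws y → Covers ws′ y)
  explore-sound []       (here refl) ws = ws , λ { (inj₂ c) → c }
  explore-sound {ρ} (x ∷ xs) σ∈ ws with ∈-refine⁻ x (explore ρ xs) σ∈
  ... | τ , τ∈ , p with merge p ws
  ...   | ws₁ , c , f with explore-sound xs τ∈ ws₁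
  ...     | ws₂ , g = ws₂ , λ
    { (inj₁ (here refl)) → g (inj₂ c)
    ; (inj₁ (there y∈))  → g (inj₁ y∈)
    ; (inj₂ y∈)          → g (inj₂ (f y∈)) }

  -- Cutting loses no covered vertex, so the next vertex still lies on some walk, and that walk
  -- tells which segment to split.
  explore-complete : ∀ {ρ} xs (ws : System ρ) → (∀ {y} → y ∈ xs → Covers ws y) →
    ∃[ σ ] σ ∈ explore ρ xs × Σ[ ws′ ∈ System σ ] (∀ {y} → Covers ws y → Covers ws′ y)
  explore-complete []       ws cov = _ , here refl , ws , id
  explore-complete (x ∷ xs) ws cov with explore-complete xs ws (cov ∘ there)
  ... | σ , σ∈ , ws₁ , f with divide ws₁ (f (cov (here refl)))
  ...   | τ , p , ws₂ , g = τ , ∈-refine⁺ σ∈ p , ws₂ , g ∘ f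

  Covers⁻ : ∀ {σ x} (ws : System σ) → Covers ws x →
            ∃[ s ] Σ[ m ∈ s ∈ σ ] x ∈ walkVertices (proj₁ (All.lookup ws m))
  Covers⁻ (w ∷ ws) (inj₁ x∈) = _ , here refl , x∈
  Covers⁻ (w ∷ ws) (inj₂ c) with Covers⁻ ws c
  ... | s , m , x∈ = s , there m , x∈

  Covers⁺ : ∀ {σ s x} (ws : System σ) (m : s ∈ σ) →
            x ∈ walkVertices (proj₁ (All.lookup ws m)) → Covers ws x
  Covers⁺ (w ∷ ws) (here refl) x∈ = inj₁ x∈
  Covers⁺ (w ∷ ws) (there m)   x∈ = inj₂ (Covers⁺ ws m x∈)

  Covering : Set
  Covering = Σ[ ws ∈ System pairs ] (∀ x → x ∉ₛ S → Covers ws x)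

  strongGeodetic⇒covering : IsStrongGeodetic S → Covering
  strongGeodetic⇒covering (I , cov) = ws , λ x x∉S →
    let u , v , u∈S , v∈S , u<v , x∈P = cov x x∉S
        m = ∈-pairs⁺ u∈S v∈S u<v
    in Covers⁺ ws m
         (subst (λ P → x ∈ walkVertices (proj₁ P)) (sym (lookup-chosen m u∈S v∈S u<v)) x∈P)
    where
    choose : ∀ {s} → s ∈ pairs → Geodesic (proj₁ s) (proj₂ s)
    choose m with ∈-pairs⁻ m
    ... | u∈S , v∈S , u<v = shortestPath⇒geodesic (I _ _ u∈S v∈S u<v)
    ws : System pairs
    ws = All.tabulate choose
    lookup-chosen : ∀ {u v} (m : (u , v) ∈ pairs) u∈S v∈S u<v →
      All.lookup ws m ≡ shortestPath⇒geodesic (I u v u∈S v∈S u<v)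
    lookup-chosen m u∈S v∈S u<v = trans (lookup-tabulate choose m) (chosen m)
      where
      chosen : ∀ m → choose m ≡ shortestPath⇒geodesic (I _ _ u∈S v∈S u<v)
      chosen m with ∈-pairs⁻ m
      ... | u∈S′ , v∈S′ , u<v′
        -- The assignment takes proofs as arguments, and those recovered from the position in
        -- `pairs` are identified with the given ones by proof irrelevance.
        with []=-irrelevant u∈S u∈S′ | []=-irrelevant v∈S v∈S′ | <-irrelevant u<v u<v′
      ...   | refl | refl | refl = refl

  covering⇒strongGeodetic : Covering → IsStrongGeodetic S
  covering⇒strongGeodetic (ws , cov) = I , λ x x∉S →
    let s , m , x∈ = Covers⁻ ws (cov x x∉S)
        u∈S , v∈S , u<v = ∈-pairs⁻ m
    in _ , _ , u∈S , v∈S , u<v ,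
       -- `I` looks its walk up at a position computed from the proofs; as `pairs` has no
       -- repetitions, this is the position `m`.
       subst (λ m → x ∈ walkVertices (proj₁ (All.lookup ws m)))
             (unique⇒irrelevant unique-pairs m (∈-pairs⁺ u∈S v∈S u<v)) x∈
    where
    I : ShortestPathAssignment S
    I u v u∈S v∈S u<v = geodesic⇒shortestPath (All.lookup ws (∈-pairs⁺ u∈S v∈S u<v))

  answer-correct : Reflects (IsStrongGeodetic S) answer
  answer-correct = reflect final refl
    where
    reflect : ∀ L → L ≡ final → Reflects (IsStrongGeodetic S) (nonempty L)
    reflect []      eq = ofⁿ λ yes →
      let ws , cov = strongGeodetic⇒covering yes
          σ , σ∈ , _ = explore-complete outside ws (λ y∈ → cov _ (∈-outside⁻ y∈))
      in ¬Any[] (subst (σ ∈_) (sym eq) σ∈)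
    reflect (σ ∷ L) eq = ofʸ (covering⇒strongGeodetic
      (let ws , f = explore-sound outside (subst (σ ∈_) eq (here refl))
                      -- Any geodesics for the segments of a final state will do: merging them back
                      -- makes the result pass through every vertex of `outside`.
                      (All.universal (λ (a , b) → geodesic a b) σ)
       in ws , λ x x∉S → f (inj₁ (∈-outside⁺ x∉S))))

-- Bounds on the search

module SearchSize (i : RecognitionInstance) where

  open RecognitionInstance i
  open Graph graph hiding (Vertex)
  open Algorithm order adj (lookup S)
  open Distances graph connected (lookup S)
  open Search graph connected S

  k B : ℕ
  k = ∣ S ∣
  B = kernel D k

  weight : State → ℕ
  weight []            = 0
  weight ((a , b) ∷ σ) = d a b + weight σ

  -- Keeps track of where the ends of segments come from: a vertex treated next is not among them,
  -- so both halves of a split segment have positive length.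
  Known : List V → V → Set
  Known ys x = x ∈ₛ S ⊎ x ∈ ys

  Proper : List V → Segment → Set
  Proper ys (a , b) = 1 ≤ d a b × Known ys a × Known ys b

  record Invariant (ys : List V) (σ : State) : Set where
    field
      proper   : All (Proper ys) σ
      weight-≤ : weight σ ≤ weight pairs
      length-≡ : length σ ≡ length ys + length pairs

  open Invariant

  split-All : ∀ {P Q : Segment → Set} {x} → (∀ {s} → P s → Q s) →
              (∀ {a b} → P (a , b) → Q (a , x) × Q (x , b)) →
              ∀ {σ τ} → Split x σ τ → All P σ → All Q τ
  split-All f g (here _)  (p ∷ ps) = proj₁ (g p) ∷ proj₂ (g p) ∷ All.map f ps
  split-All f g (there s) (p ∷ ps) = f p ∷ split-All f g s ps

  split-weight : ∀ {x σ τ} → Split x σ τ → weight τ ≤ weight σ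
  split-weight {x} (here {a} {b} {σ} t) =
    ≤-trans (≤-reflexive (sym (+-assoc (d a x) (d x b) (weight σ)))) (+-monoˡ-≤ (weight σ) t)
  split-weight (there {a , b} s) = +-monoʳ-≤ (d a b) (split-weight s)

  split-length : ∀ {x σ τ} → Split x σ τ → length τ ≡ suc (length σ)
  split-length (here _)  = refl
  split-length (there s) = cong suc (split-length s)

  invariant-pairs : Invariant [] pairs
  invariant-pairs = record
    { proper   = All.tabulate λ m → let a∈S , b∈S , a<b = ∈-pairs⁻ m in
                 d-positive (λ { refl → <-irrefl refl a<b }) , inj₁ a∈S , inj₁ b∈S
    ; weight-≤ = ≤-refl
    ; length-≡ = refl
    }

  invariant-split : ∀ {x ys σ τ} → x ∉ₛ S → x ∉ ys → Split x σ τ →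
                    Invariant ys σ → Invariant (x ∷ ys) τ
  invariant-split {x} {ys} x∉S x∉ys s inv = record
    { proper   = split-All (λ (p , ka , kb) → p , map₂ there ka , map₂ there kb)
        (λ { (p , ka , kb) →
          (d-positive (λ { refl → unknown ka }) , map₂ there ka , inj₂ (here refl)) ,
          (d-positive (λ { refl → unknown kb }) , inj₂ (here refl) , map₂ there kb) })
        s (proper inv)
    ; weight-≤ = ≤-trans (split-weight s) (weight-≤ inv)
    ; length-≡ = trans (split-length s) (cong suc (length-≡ inv))
    }
    where
    unknown : ¬ Known ys x
    unknown (inj₁ x∈S)  = x∉S x∈S
    unknown (inj₂ x∈ys) = x∉ys x∈ys

  Admissible : List V → Set
  Admissible xs = Unique xs × All (_∉ₛ S) xs

  admissible-tail : ∀ x xs → Admissible (x ∷ xs) → Admissible xs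
  admissible-tail x xs (_ ∷ u , _ ∷ out) = u , out

  admissible-outside : Admissible outside
  admissible-outside = unique-outside , All.tabulate ∈-outside⁻

  invariant : ∀ xs {σ} → Admissible xs → σ ∈ explore pairs xs → Invariant xs σ
  invariant []       _ (here refl) = invariant-pairs
  invariant (x ∷ xs) (x∉ ∷ u , x∉S ∷ out) σ∈ with ∈-refine⁻ x (explore pairs xs) σ∈
  ... | τ , τ∈ , s = invariant-split x∉S (λ x∈ → All.lookup x∉ x∈ refl) s (invariant xs (u , out) τ∈)

  length≤weight : ∀ {ys σ} → All (Proper ys) σ → length σ ≤ weight σ
  length≤weight []             = z≤n
  length≤weight ((p , _) ∷ ps) = +-mono-≤ p (length≤weight ps)

  weight≤ : ∀ σ → weight σ ≤ length σ * D
  weight≤ []            = z≤n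
  weight≤ ((a , b) ∷ σ) = +-mono-≤ (d-≤-diameter hasDiameter a b) (weight≤ σ)

  state-length : ∀ xs {σ} → Admissible xs → σ ∈ explore pairs xs → length σ ≤ k * k * D
  state-length xs {σ} ok σ∈ = begin
    length σ          ≤⟨ length≤weight (proper inv) ⟩
    weight σ          ≤⟨ weight-≤ inv ⟩
    weight pairs      ≤⟨ weight≤ pairs ⟩
    length pairs * D  ≤⟨ *-monoˡ-≤ D length-pairs ⟩
    k * k * D         ∎
    where
    open ≤-Reasoning
    inv = invariant xs ok σ∈

  -- Each treated vertex has added one segment, so the bound on the length of a state also bounds
  -- its depth.
  depth : ∀ xs {σ} → Admissible xs → σ ∈ explore pairs xs → length xs ≤ k * k * D
  depth xs ok σ∈ = ≤-trans
    (≤-trans (m≤m+n (length xs) (length pairs)) (≤-reflexive (sym (length-≡ (invariant xs ok σ∈)))))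
    (state-length xs ok σ∈)

  length-refine : ∀ {m} x L → All (λ σ → length σ ≤ m) L → length (refine x L) ≤ length L * m
  length-refine x []      []       = z≤n
  length-refine x (σ ∷ L) (p ∷ ps) = ≤-trans (≤-reflexive (length-++ (splits x σ)))
    (+-mono-≤ (≤-trans (length-splits x σ) p) (length-refine x L ps))

  state-lengths : ∀ xs → Admissible xs → All (λ σ → length σ ≤ B) (explore pairs xs)
  state-lengths xs ok = All.tabulate λ σ∈ → m≤n⇒m≤1+n (state-length xs ok σ∈)

  -- A state of at most `B` segments has at most `B` successors.
  length-explore-depth : ∀ xs → Admissible xs → length (explore pairs xs) ≤ B ^ length xs
  length-explore-depth []       ok = ≤-refl
  length-explore-depth (x ∷ xs) ok = begin
    length (refine x (explore pairs xs)) ≤⟨ length-refine x (explore pairs xs) (state-lengths xs ok′) ⟩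
    length (explore pairs xs) * B        ≤⟨ *-monoˡ-≤ B (length-explore-depth xs ok′) ⟩
    B ^ length xs * B                    ≡⟨ *-comm (B ^ length xs) B ⟩
    B * B ^ length xs                    ∎
    where
    open ≤-Reasoning
    ok′ = admissible-tail x xs ok

  -- A nonempty level has depth at most `k * k * D`, which is below `B`. An empty level satisfies
  -- any bound, so the number of vertices disappears from the exponent.
  length-explore : ∀ xs → Admissible xs → length (explore pairs xs) ≤ B ^ B
  length-explore xs ok with explore pairs xs in eq
  ... | []    = z≤n
  ... | σ ∷ L = subst (λ L → length L ≤ B ^ B) eq (≤-trans (length-explore-depth xs ok)
    (^-monoʳ-≤ B (m≤n⇒m≤1+n (depth xs ok (subst (σ ∈_) (sym eq) (here refl))))))

  encoding : Tree
  encoding = encodeInstance i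

  -- The product lies above both factors, hence above all lists traversed, and its powers separate
  -- into a power of the input size and a function of the parameters.
  N : ℕ
  N = size encoding * B ^ B

  size-encodeList : ∀ ts → length ts ≤ size (encodeList ts)
  size-encodeList []       = z≤n
  size-encodeList (t ∷ ts) = s≤s (≤-trans (size-encodeList ts) (m≤n+m _ _))

  length-toList-map : ∀ {n} (T : Subset n) → length (toList (Vec.map encodeBool T)) ≡ n
  length-toList-map []      = refl
  length-toList-map (_ ∷ T) = cong suc (length-toList-map T)

  order≤size : order ≤ size encoding
  order≤size = ≤-trans (≤-reflexive (sym (length-toList-map S)))
    (≤-trans (size-encodeList (toList (Vec.map encodeBool S))) (m≤n⇒m≤1+n (m≤n+m _ _)))

  1≤B^B : 1 ≤ B ^ B
  1≤B^B = m^n>0 B B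

  size≤N : size encoding ≤ N
  size≤N = ≤-trans (≤-reflexive (sym (*-identityʳ (size encoding)))) (*-monoʳ-≤ (size encoding) 1≤B^B)

  B^B≤N : B ^ B ≤ N
  B^B≤N = ≤-trans (≤-reflexive (sym (*-identityˡ (B ^ B)))) (*-monoˡ-≤ (B ^ B) {1} {size encoding} (s≤s z≤n))

  B≤N : B ≤ N
  B≤N = ≤-trans (≤-trans (≤-reflexive (sym (^-identityʳ B))) (^-monoʳ-≤ B {1} {B} (s≤s z≤n))) B^B≤N

  order≤N : order ≤ N
  order≤N = ≤-trans order≤size size≤N

  affordable : Ample N
  affordable =
    order≤N , (λ t u v → ≤-trans (<⇒≤ (dist<order t u v)) order≤N) ,
    ≤-trans (length-unique unique-outside) order≤N ,
    ≤-trans (length-unique unique-inside) order≤N ,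
    suffixes-hereditary Admissible admissible-tail
      (λ x xs ok → let ok′ = admissible-tail x xs ok in
        ≤-trans (length-explore xs ok′) B^B≤N ,
        All.map (λ short → ≤-trans short B≤N) (state-lengths xs ok′))
      outside admissible-outside

-- The recognizer and its running time.

^-distribʳ-* : ∀ e m n → (m * n) ^ e ≡ m ^ e * n ^ e
^-distribʳ-* zero    m n = refl
^-distribʳ-* (suc e) m n = trans (cong (m * n *_) (^-distribʳ-* e m n))
  ([m*n]*[o*p]≡[m*o]*[n*p] m n (m ^ e) (n ^ e))

abstract

  -- The compiled code is the same for all graphs, so it can be read off from
  -- the empty one.
  recognizer : Code
  recognizer = alone (program (Algorithm.decideF 0 (λ ()) (λ ())))

  recognizer-uniform : ∀ n adj S → alone (program (Algorithm.decideF n adj S)) ≡ recognizer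
  recognizer-uniform n adj S = refl

toList-encode : ∀ {n} (T : Subset n) →
  encodeList (tabulate (encodeBool ∘ lookup T)) ≡ encodeList (toList (Vec.map encodeBool T))
toList-encode []      = refl
toList-encode (b ∷ T) = cong (encodeBool b ∙_) (toList-encode T)

module Recognition (i : RecognitionInstance) where

  open RecognitionInstance i
  open Graph graph
  open Algorithm order adj (lookup S)
  open SearchSize i

  execution : Exec recognizer encoding (encodeBool answer) (λ M → Ample M)
  execution =
    subst₂ (λ c t → Exec c t (encodeBool answer) (λ M → Ample M))
      (recognizer-uniform order adj (lookup S))
      -- The adjacency matrices agree by computation; for `S` a tabulated lookup has to be matched
      -- with the mapped vector.
      (cong (encode (matrix bool) adj ∙_) (toList-encode S))
      (runs decideF tt)

  runs-recognizer : Runs (single recognizer) encoding (encodeBool answer) (time execution)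
  runs-recognizer = record { final = _ ; halts = run execution ; outputs = refl }

  recognizer-correct : Reflects (IsStrongGeodetic S) answer
  recognizer-correct = Search.answer-correct graph connected S

  recognizer-time : let e = degree recognizer in
    time execution ≤ coeff recognizer * (fpt-bound e D k * size encoding ^ suc e)
  recognizer-time = begin
    time execution
      ≤⟨ bound execution (≤-trans 1≤B^B B^B≤N) affordable ⟩
    K * N ^ e
      ≡⟨ cong (K *_) (^-distribʳ-* e n (B ^ B)) ⟩
    K * (n ^ e * (B ^ B) ^ e)
      ≡⟨ cong (K *_) (*-comm (n ^ e) _) ⟩
    K * (fpt-bound e D k * n ^ e)
      -- The exponent is raised to `suc e` because it is required to be positive.
      ≤⟨ *-monoʳ-≤ K (*-monoʳ-≤ (fpt-bound e D k) (^-monoʳ-≤ n (n≤1+n e))) ⟩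
    K * (fpt-bound e D k * n ^ suc e)
      ∎
    where
    open ≤-Reasoning
    K = coeff recognizer
    e = degree recognizer
    n = size encoding

mainTheorem6 : FixedParameterTractable StrongGeodeticRecognition
mainTheorem6 =
  single recognizer , fpt-bound e , suc e , coeff recognizer ,
  fpt-bound-computable e , s≤s z≤n , λ i →
  _ , _ , Recognition.runs-recognizer i , Recognition.recognizer-correct i ,
  Recognition.recognizer-time i
  where
  e : ℕ
  e = degree recognizer
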